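{- Let $c_0$ be the rainbow $3$-colouring of $T\cong\mathrm{PG}(1,2)$, i.e. the three points of $T$ receive the three distinct colours $1,2,3$. Then for every $n\in\mathbb N$ and every $c_0$-free $3$-colouring $c:\mathrm{PG}(n-1,2)\to\{1,2,3\}$, there is a subspace $V$ of $\mathrm{PG}(n-1,2)$ with $\dim(V)\ge \tfrac13 n$ and a colour $i\in\{1,2,3\}$ such that no point of $V$ has colour $i$. Moreover the values $C=\tfrac13$ and exponent $\delta=1$ are best possible: there is no pair $(C',\delta')$ with either $\delta'>1$, or $\delta'=1$ and $C'>\tfrac13$, such that every $c_0$-free $3$-colouring of $\mathrm{PG}(n-1,2)$ (for every $n$) has a subspace of dimension at least $C'n^{\delta'}$ avoiding some colour.
   Context: $\mathrm{PG}(n-1,2)$ is the binary projective geometry, whose points may be identified with the nonzero vectors of $\mathbb F_2^n$; a subspace of it is the set of nonzero vectors of a linear subspace of $\mathbb F_2^n$, and its dimension is the dimension of that linear subspace. $T=\mathrm{PG}(1,2)$ is the set of three nonzero vectors of $\mathbb F_2^2$. If $c$ is a colouring of $\mathrm{PG}(n-1,2)$ and $c_0$ a colouring of $\mathrm{PG}(k-1,2)$, then $c$ contains $c_0$ if there is an injective linear map $\psi:\mathbb F_2^k\to\mathbb F_2^n$ with $c(\psi(x))=c_0(x)$ for every nonzero $x\in\mathbb F_2^k$; $c$ is $c_0$-free if it does not contain $c_0$.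
   Formalization: In the optimality clause C' is required to be positive when δ'>1 (for C'≤0 the zero-dimensional subspace always works, so the claim as worded fails); C' and δ' are taken rational, which is equivalent by density and monotonicity. -}

module Defs where

open import Data.Bool using (Bool; true; false; _xor_; _∧_)
open import Data.Nat using (ℕ; zero; suc)
open import Data.Fin using (Fin)
open import Data.Vec using (Vec; []; _∷_; replicate; zipWith; map)
open import Data.Integer using (+_)
open import Data.Rational using (ℚ; _/_; _*_; 1ℚ)
open import Data.Product using (Σ; _×_; ∃)
open import Relation.Binary.PropositionalEquality using (_≡_; _≢_)
open import Relation.Nullary using (¬_)
open import Function.Definitions using (Injective)

F₂^ : ℕ → Set
F₂^ n = Vec Bool n

𝟎 : ∀ {n} → F₂^ n
𝟎 = replicate _ false

_⊕_ : ∀ {n} → F₂^ n → F₂^ n → F₂^ n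
_⊕_ = zipWith _xor_

_·_ : ∀ {n} → Bool → F₂^ n → F₂^ n
a · x = map (a ∧_) x

-- Points of PG(n-1,2) = nonzero vectors of F_2^n.
NonZeroVec : ∀ {n} → F₂^ n → Set
NonZeroVec x = x ≢ 𝟎

IsLinear : ∀ {k n} → (F₂^ k → F₂^ n) → Set
IsLinear ψ = (∀ x y → ψ (x ⊕ y) ≡ ψ x ⊕ ψ y) × (∀ a x → ψ (a · x) ≡ a · ψ x)

Embedding : ℕ → ℕ → Set
Embedding k n = Σ (F₂^ k → F₂^ n) λ ψ → IsLinear ψ × Injective _≡_ _≡_ ψ

-- A 3-colouring of PG(n-1,2), colours {1,2,3} represented by Fin 3.
-- (Given as a function on all of F_2^n; only its values at nonzero vectors matter.)
Colouring : ℕ → Set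
Colouring n = F₂^ n → Fin 3

Contains : ∀ {n k} → Colouring n → Colouring k → Set
Contains {n} {k} c c₀ =
  Σ (Embedding k n) λ e → ∀ (x : F₂^ k) → NonZeroVec x → c (Σ.proj₁ e x) ≡ c₀ x
  where open Data.Product using (proj₁)

Free : ∀ {n k} → Colouring n → Colouring k → Set
Free c c₀ = ¬ Contains c c₀

rainbow : Colouring 2
rainbow (true ∷ false ∷ []) = Fin.zero
rainbow (false ∷ true ∷ []) = Fin.suc Fin.zero
rainbow (true ∷ true ∷ []) = Fin.suc (Fin.suc Fin.zero)
rainbow (false ∷ false ∷ []) = Fin.zero  -- the zero vector is not a point of T; value irrelevant

-- A subspace of PG(n-1,2) of dimension d is given as the image of an injective linear
-- map φ : F_2^d → F_2^n; its points are φ x for nonzero x.  It avoids colour i under c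
-- if none of its points has colour i.
AvoidsColour : ∀ {d n} → Colouring n → Embedding d n → Fin 3 → Set
AvoidsColour c e i = ∀ x → NonZeroVec x → c (Σ.proj₁ e x) ≢ i

_^ℚ_ : ℚ → ℕ → ℚ
q ^ℚ zero = 1ℚ
q ^ℚ suc m = q * (q ^ℚ m)

⅓ : ℚ
⅓ = + 1 / 3

{-# OPTIONS --safe #-}
-- Upper bound. If some colour class i lies in a proper subspace, project along its span: a
-- complement of the kernel avoids i and can be added to any i-avoiding subspace of the kernel,
-- so by induction the best dimensions for the three colours sum to at least n. Some class
-- must indeed fail to span: otherwise take a hyperplane H; inductively some class i of H lies
-- in F < H and the colouring of H \ F descends to H / F. As class i spans the whole space, it has
-- a point r outside H, and the cosets of r + F that meet class i give a spanning set A of H / F;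
-- rainbow-freeness makes the colouring of H / F so rigid under translation by A that the other
-- two colours cannot both occur outside H.
--
-- Sharpness. Stack three generic 2-colourings, with colour pairs {2,3}, {1,3}, {1,2}, on
-- m-dimensional blocks: the colour of a vector is read off its first nonzero block. A subspace
-- avoiding a colour is small in the two blocks using that colour, so it has dimension at most m + o(m).
module Submission where

open import Defs
open import Data.Nat as ℕ using (ℕ; zero; suc; _≥_; _>_)
open import Data.Fin using (Fin; zero; suc; punchIn; punchOut)
open import Data.Integer as ℤ using (+_; -[1+_])
open import Data.Rational using (ℚ; mkℚ; _≤_; _<_; _*_; 0ℚ; 1ℚ; _/_; *<*; toℚᵘ;
  Positive; NonNegative; positive)
open import Data.Product using (Σ; ∃; ∃₂; _×_; _,_; proj₁; proj₂; uncurry)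
open import Data.Sum as Sum using (_⊎_; inj₁; inj₂)
open import Relation.Binary.PropositionalEquality
  using (_≡_; _≢_; refl; sym; trans; cong; cong₂; subst; subst₂; module ≡-Reasoning)
open import Relation.Nullary using (¬_; Dec; yes; no; contradiction)
open import Relation.Nullary.Decidable using (map′; _×-dec_; ¬?; decidable-stable)
open import Relation.Unary using (Decidable)

open import Algebra.Bundles using (CommutativeMonoid)
open import Data.Bool using (Bool; true; false; if_then_else_; _xor_)
import Data.Bool.Properties as Bool
open import Data.Empty using (⊥)
open import Data.Fin.Patterns using (0F; 1F; 2F)
import Data.Fin.Properties as Fin
import Data.Integer.Properties as ℤ
open import Data.List as List using (List; []; _∷_; length; allFin)
import Data.List.Properties as List
open import Data.List.Membership.Propositional using (_∈_)
open import Data.List.Membership.Propositional.Properties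
  using (∈-filter⁺; ∈-map⁺; ∈-allFin; ∈-++⁺ˡ; ∈-++⁺ʳ)
open import Data.List.Relation.Unary.All as All using (All; []; _∷_)
open import Data.List.Relation.Unary.All.Properties using (all-filter)
open import Data.Maybe using (Maybe; just; nothing)
open import Data.Nat.Coprimality using (Coprime)
open import Data.Nat.Induction using (<-rec)
open import Data.Nat.ListAction using (sum)
import Data.Nat.Properties as ℕ
open import Data.Nat.Tactic.RingSolver using (solve-∀)
open import Data.Product.Function.NonDependent.Propositional using (_×-↔_)
import Data.Rational.Properties as ℚ
open import Data.Rational.Unnormalised as ℚᵘ using (mkℚᵘ)
import Data.Rational.Unnormalised.Properties as ℚᵘ
open import Data.Vec using (Vec; []; _∷_; uncons; head; take; drop)
open import Data.Vec.Properties using (zipWith-assoc; zipWith-comm; zipWith-identityˡ;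
  map-const; map-id; ≡-dec; take-zipWith; drop-zipWith; ∷-injectiveʳ)
open import Function using (_∘_; id; const; _↔_; mk↔ₛ′; Inverse; Injection)
open import Function.Definitions using (Injective)
open import Function.Properties.Inverse using (↔-trans; ↔-sym; ↔⇒↣)
open import Algebra.Properties.CommutativeSemigroup
  (CommutativeMonoid.commutativeSemigroup ℚ.*-1-commutativeMonoid) using (interchange)

private variable
  d k m n t w vars ℓ : ℕ
  b c : Bool

-- Enumeration of finite vector spaces

Vec-↔ : {A : Set} → Fin k ↔ A → ∀ t → Fin (k ℕ.^ t) ↔ Vec A t
Vec-↔ e zero    = mk↔ₛ′ (λ _ → []) (λ _ → zero) (λ { [] → refl }) (λ { zero → refl })
Vec-↔ e (suc t) = ↔-trans Fin.*↔× (↔-trans (e ×-↔ Vec-↔ e t)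
  (mk↔ₛ′ (uncurry _∷_) uncons (λ { (_ ∷ _) → refl }) (λ { (_ , _) → refl })))

abstract
  F₂^-↔ : ∀ n → Fin (2 ℕ.^ n) ↔ F₂^ n
  F₂^-↔ = Vec-↔ Fin.2↔Bool

-- Finiteness of the space allows exhaustive search, which keeps the later case distinctions
-- constructive.
search : {P : F₂^ n → Set} → Decidable P → Dec (∃ P)
search {n} {P} P? = map′
  (λ (j , p) → to j , p)
  (λ (x , p) → from x , subst P (sym (strictlyInverseˡ x)) p)
  (Fin.any? (P? ∘ to))
  where open Inverse (F₂^-↔ n)

2^-cancel-≤ : ∀ d n → 2 ℕ.^ d ℕ.≤ 2 ℕ.^ n → d ℕ.≤ n
2^-cancel-≤ d n le = ℕ.≮⇒≥ λ n<d → ℕ.<⇒≱ (ℕ.^-monoʳ-< 2 (ℕ.s≤s (ℕ.s≤s ℕ.z≤n)) n<d) le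

injective⇒≤ : (ψ : F₂^ d → F₂^ n) → Injective _≡_ _≡_ ψ → d ℕ.≤ n
injective⇒≤ {d} {n} ψ inj = 2^-cancel-≤ d n (Fin.injective⇒≤ {f = from target ∘ ψ ∘ to source}
  (Injection.injective (↔⇒↣ source) ∘ inj ∘ Injection.injective (↔⇒↣ (↔-sym target))))
  where
  open Inverse
  source = F₂^-↔ d
  target = F₂^-↔ n

-- Vector arithmetic over the two-element field

_≟_ : (x y : F₂^ n) → Dec (x ≡ y)
_≟_ = ≡-dec Bool._≟_

⊕-assoc : (x y z : F₂^ n) → (x ⊕ y) ⊕ z ≡ x ⊕ (y ⊕ z)
⊕-assoc = zipWith-assoc Bool.xor-assoc

⊕-comm : (x y : F₂^ n) → x ⊕ y ≡ y ⊕ x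
⊕-comm = zipWith-comm Bool.xor-comm

⊕-identityˡ : (x : F₂^ n) → 𝟎 ⊕ x ≡ x
⊕-identityˡ = zipWith-identityˡ (λ _ → refl)

⊕-identityʳ : (x : F₂^ n) → x ⊕ 𝟎 ≡ x
⊕-identityʳ x = trans (⊕-comm x 𝟎) (⊕-identityˡ x)

⊕-same : (x : F₂^ n) → x ⊕ x ≡ 𝟎
⊕-same []      = refl
⊕-same (b ∷ x) = cong₂ _∷_ (Bool.xor-same b) (⊕-same x)

⊕-cancelˡ : (x y : F₂^ n) → x ⊕ (x ⊕ y) ≡ y
⊕-cancelˡ x y = trans (sym (⊕-assoc x x y)) (trans (cong (_⊕ y) (⊕-same x)) (⊕-identityˡ y))

⊕-cancelʳ : (x y : F₂^ n) → (x ⊕ y) ⊕ y ≡ x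
⊕-cancelʳ x y = trans (⊕-assoc x y y) (trans (cong (x ⊕_) (⊕-same y)) (⊕-identityʳ x))

⊕≡𝟎⇒≡ : {x y : F₂^ n} → x ⊕ y ≡ 𝟎 → x ≡ y
⊕≡𝟎⇒≡ {x = x} {y} eq = trans (sym (⊕-cancelʳ x y)) (trans (cong (_⊕ y) eq) (⊕-identityˡ y))

⊕-interchange : (x y z u : F₂^ n) → (x ⊕ y) ⊕ (z ⊕ u) ≡ (x ⊕ z) ⊕ (y ⊕ u)
⊕-interchange x y z u = begin
  (x ⊕ y) ⊕ (z ⊕ u)  ≡⟨ ⊕-assoc x y (z ⊕ u) ⟩
  x ⊕ (y ⊕ (z ⊕ u))  ≡⟨ cong (x ⊕_) (sym (⊕-assoc y z u)) ⟩
  x ⊕ ((y ⊕ z) ⊕ u)  ≡⟨ cong (λ v → x ⊕ (v ⊕ u)) (⊕-comm y z) ⟩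
  x ⊕ ((z ⊕ y) ⊕ u)  ≡⟨ cong (x ⊕_) (⊕-assoc z y u) ⟩
  x ⊕ (z ⊕ (y ⊕ u))  ≡⟨ sym (⊕-assoc x z (y ⊕ u)) ⟩
  (x ⊕ z) ⊕ (y ⊕ u)  ∎
  where open ≡-Reasoning

-- Linear maps, embeddings and complements of kernels

Additive : (F₂^ k → F₂^ n) → Set
Additive ψ = ∀ x y → ψ (x ⊕ y) ≡ ψ x ⊕ ψ y

additive-𝟎 : {ψ : F₂^ k → F₂^ n} → Additive ψ → ψ 𝟎 ≡ 𝟎
additive-𝟎 {ψ = ψ} add = begin
  ψ 𝟎                  ≡⟨ sym (⊕-cancelʳ (ψ 𝟎) (ψ 𝟎)) ⟩
  (ψ 𝟎 ⊕ ψ 𝟎) ⊕ ψ 𝟎    ≡⟨ cong (_⊕ ψ 𝟎) (sym (add 𝟎 𝟎)) ⟩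
  ψ (𝟎 ⊕ 𝟎) ⊕ ψ 𝟎      ≡⟨ cong (λ z → ψ z ⊕ ψ 𝟎) (⊕-identityˡ 𝟎) ⟩
  ψ 𝟎 ⊕ ψ 𝟎            ≡⟨ ⊕-same (ψ 𝟎) ⟩
  𝟎                    ∎
  where open ≡-Reasoning

-- The only scalars are 0 and 1, so homogeneity amounts to `ψ 𝟎 ≡ 𝟎`, which additivity forces.
additive⇒linear : {ψ : F₂^ k → F₂^ n} → Additive ψ → IsLinear ψ
additive⇒linear {ψ = ψ} add = add , λ
  { true  x → trans (cong ψ (map-id x)) (sym (map-id (ψ x)))
  ; false x → trans (cong ψ (map-const x false))
                (trans (additive-𝟎 add) (sym (map-const (ψ x) false))) }

embedding : (ψ : F₂^ k → F₂^ n) → Additive ψ → (∀ x → ψ x ≡ 𝟎 → x ≡ 𝟎) → Embedding k n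
embedding ψ add ker = ψ , additive⇒linear add , λ {x} {y} eq →
  ⊕≡𝟎⇒≡ (ker (x ⊕ y) (trans (add x y) (trans (cong (_⊕ ψ y) eq) (⊕-same (ψ y)))))

module Emb (e : Embedding k n) where
  fun : F₂^ k → F₂^ n
  fun = proj₁ e
  add : Additive fun
  add = proj₁ (proj₁ (proj₂ e))
  injective : Injective _≡_ _≡_ fun
  injective = proj₂ (proj₂ e)
  ker : ∀ x → fun x ≡ 𝟎 → x ≡ 𝟎
  ker x eq = injective (trans eq (sym (additive-𝟎 add)))

open Emb using (fun)

_∘ₑ_ : Embedding m n → Embedding k m → Embedding k n
e ∘ₑ e′ = embedding (fun e ∘ fun e′)
  (λ x y → trans (cong (fun e) (Emb.add e′ x y)) (Emb.add e _ _))
  (λ x → Emb.ker e′ x ∘ Emb.ker e _)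

cons-false : Embedding n (suc n)
cons-false = embedding (false ∷_) (λ _ _ → refl) (λ _ → ∷-injectiveʳ)

-- In matrix terms, `v` is put in front of the columns of `ψ`.
extend : F₂^ n → (F₂^ k → F₂^ n) → F₂^ (suc k) → F₂^ n
extend v ψ (false ∷ y) = ψ y
extend v ψ (true  ∷ y) = v ⊕ ψ y

extend-additive : (v : F₂^ n) {ψ : F₂^ k → F₂^ n} → Additive ψ → Additive (extend v ψ)
extend-additive v {ψ} add (false ∷ x) (false ∷ y) = add x y
extend-additive v {ψ} add (true  ∷ x) (false ∷ y) =
  trans (cong (v ⊕_) (add x y)) (sym (⊕-assoc v _ _))
extend-additive v {ψ} add (false ∷ x) (true  ∷ y) = begin
  v ⊕ ψ (x ⊕ y)      ≡⟨ cong (λ z → v ⊕ ψ z) (⊕-comm x y) ⟩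
  v ⊕ ψ (y ⊕ x)      ≡⟨ cong (v ⊕_) (add y x) ⟩
  v ⊕ (ψ y ⊕ ψ x)    ≡⟨ sym (⊕-assoc v _ _) ⟩
  (v ⊕ ψ y) ⊕ ψ x    ≡⟨ ⊕-comm _ _ ⟩
  ψ x ⊕ (v ⊕ ψ y)    ∎
  where open ≡-Reasoning
extend-additive v {ψ} add (true  ∷ x) (true  ∷ y) = begin
  ψ (x ⊕ y)                  ≡⟨ add x y ⟩
  ψ x ⊕ ψ y                  ≡⟨ sym (⊕-identityˡ _) ⟩
  𝟎 ⊕ (ψ x ⊕ ψ y)            ≡⟨ cong (_⊕ (ψ x ⊕ ψ y)) (sym (⊕-same v)) ⟩
  (v ⊕ v) ⊕ (ψ x ⊕ ψ y)      ≡⟨ ⊕-interchange v v _ _ ⟩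
  (v ⊕ ψ x) ⊕ (v ⊕ ψ y)      ∎
  where open ≡-Reasoning

true∷-additive : {g : F₂^ (suc d) → F₂^ m} → Additive g →
  ∀ x → g (true ∷ x) ≡ g (true ∷ 𝟎) ⊕ g (false ∷ x)
true∷-additive {g = g} add x =
  trans (cong (g ∘ (true ∷_)) (sym (⊕-identityˡ x))) (add (true ∷ 𝟎) (false ∷ x))

-- Rank-nullity with witnesses: for additive `g`, `κ` parametrises the kernel (`dims` forces it to
-- fill the kernel) and `ω` a complement, on which `g` is injective with full image.
record Splitting (g : F₂^ d → F₂^ m) : Set where
  field
    {kdim cdim} : ℕ
    dims        : kdim ℕ.+ cdim ≡ d
    κ           : Embedding kdim d
    ω           : Embedding cdim d
    κ-killed    : ∀ y → g (fun κ y) ≡ 𝟎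
    ω-ker       : ∀ z → g (fun ω z) ≡ 𝟎 → z ≡ 𝟎
    ω-onto      : ∀ x → ∃ λ z → g (fun ω z) ≡ g x

-- Gaussian elimination, one coordinate at a time. If the image `e` of the new basis vector is
-- already attained on the complement, adding a preimage to the basis vector gives a new kernel
-- vector; otherwise the basis vector enlarges the complement.
splitting : (g : F₂^ d → F₂^ m) → Additive g → Splitting g
splitting {zero} g add = record
  { dims = refl ; κ = idₑ ; ω = idₑ
  ; κ-killed = λ { [] → additive-𝟎 add } ; ω-ker = λ { [] _ → refl } ; ω-onto = λ x → x , refl }
  where
  idₑ : Embedding 0 0
  idₑ = embedding id (λ _ _ → refl) (λ _ → id)
splitting {suc d} g add = step (search λ z → g (false ∷ fun S.ω z) ≟ e)
  where
  module S = Splitting (splitting (g ∘ (false ∷_)) (λ x y → add (false ∷ x) (false ∷ y)))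
  e = g (true ∷ 𝟎)
  κ′ = cons-false ∘ₑ S.κ
  ω′ = cons-false ∘ₑ S.ω
  split-true : ∀ x → g (true ∷ x) ≡ e ⊕ g (false ∷ x)
  split-true = true∷-additive add
  step : Dec (∃ λ z → g (false ∷ fun S.ω z) ≡ e) → Splitting g
  step (yes (z₀ , gωz₀≡e)) = record
    { dims     = cong suc S.dims
    ; κ        = embedding (extend (true ∷ v) (fun κ′)) (extend-additive _ (Emb.add κ′))
                   λ { (false ∷ y) eq → cong (false ∷_) (Emb.ker κ′ y eq) ; (true ∷ y) () }
    ; ω        = ω′
    ; κ-killed = λ { (false ∷ y) → S.κ-killed y
                   ; (true ∷ y) → trans (add (true ∷ v) _)
                       (trans (cong₂ _⊕_ gv≡𝟎 (S.κ-killed y)) (⊕-identityˡ 𝟎)) }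
    ; ω-ker    = S.ω-ker
    ; ω-onto   = λ { (false ∷ x) → S.ω-onto x
                   ; (true ∷ x) → let z , eq = S.ω-onto x in z₀ ⊕ z , (begin
                       g (fun ω′ (z₀ ⊕ z))            ≡⟨ cong g (Emb.add ω′ z₀ z) ⟩
                       g (fun ω′ z₀ ⊕ fun ω′ z)       ≡⟨ add _ _ ⟩
                       g (fun ω′ z₀) ⊕ g (fun ω′ z)   ≡⟨ cong₂ _⊕_ gωz₀≡e eq ⟩
                       e ⊕ g (false ∷ x)              ≡⟨ sym (split-true x) ⟩
                       g (true ∷ x)                   ∎) } }
    where
    open ≡-Reasoning
    v = fun S.ω z₀
    gv≡𝟎 : g (true ∷ v) ≡ 𝟎
    gv≡𝟎 = trans (split-true v) (trans (cong (e ⊕_) gωz₀≡e) (⊕-same e))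
  step (no e∉) = record
    { dims     = trans (ℕ.+-suc S.kdim S.cdim) (cong suc S.dims)
    ; κ        = κ′
    ; ω        = embedding ω⁺ (extend-additive _ (Emb.add ω′)) λ x eq →
                   ker⁺ x (trans (cong g eq) (additive-𝟎 add))
    ; κ-killed = S.κ-killed
    ; ω-ker    = ker⁺
    ; ω-onto   = λ { (false ∷ x) → let z , eq = S.ω-onto x in false ∷ z , eq
                   ; (true ∷ x) → let z , eq = S.ω-onto x in true ∷ z ,
                       trans (add (true ∷ 𝟎) _) (trans (cong (e ⊕_) eq) (sym (split-true x))) } }
    where
    ω⁺ : F₂^ (suc S.cdim) → F₂^ (suc d)
    ω⁺ = extend (true ∷ 𝟎) (fun ω′)
    ker⁺ : ∀ z → g (ω⁺ z) ≡ 𝟎 → z ≡ 𝟎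
    ker⁺ (false ∷ z) eq = cong (false ∷_) (S.ω-ker z eq)
    ker⁺ (true  ∷ z) eq = contradiction
      (z , sym (⊕≡𝟎⇒≡ (trans (sym (add (true ∷ 𝟎) _)) eq))) e∉

-- Spans and quotients

data Span (P : F₂^ n → Set) : F₂^ n → Set where
  𝟎∈  : Span P 𝟎
  add∈ : ∀ {x y} → P x → Span P y → Span P (x ⊕ y)

Span-map : {P : F₂^ n → Set} {Q : F₂^ m → Set} {τ : F₂^ n → F₂^ m} → Additive τ →
  (∀ x → P x → τ x ≡ 𝟎 ⊎ Q (τ x)) → ∀ {x} → Span P x → Span Q (τ x)
Span-map add P⇒Q 𝟎∈ = subst (Span _) (sym (additive-𝟎 add)) 𝟎∈
Span-map {τ = τ} add P⇒Q (add∈ {x} {y} px sy) = subst (Span _) (sym (add x y)) (lemma (P⇒Q x px))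
  where
  rest = Span-map add P⇒Q sy
  lemma : τ x ≡ 𝟎 ⊎ _ → Span _ (τ x ⊕ τ y)
  lemma (inj₁ eq) = subst (Span _) (sym (trans (cong (_⊕ τ y) eq) (⊕-identityˡ _))) rest
  lemma (inj₂ q)  = add∈ q rest

-- A move by a vector of the span is a sequence of moves by generators.
Span-absorb : {P S : F₂^ n → Set} → (∀ {x a} → S x → P a → S (x ⊕ a)) →
  ∀ {x y} → S x → Span P y → S (x ⊕ y)
Span-absorb {S = S} closed {x} sx 𝟎∈ = subst S (sym (⊕-identityʳ x)) sx
Span-absorb {S = S} closed {x} sx (add∈ {a} {y} pa sy) =
  subst S (⊕-assoc x a y) (Span-absorb {S = S} closed (closed sx pa) sy)

-- The quotient by the one-dimensional subspace {𝟎, `u`}.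
record Kill {w} (u : F₂^ (suc w)) : Set where
  field
    q      : F₂^ (suc w) → F₂^ w
    q-add  : Additive q
    q-ker  : ∀ y → q y ≡ 𝟎 → y ≡ 𝟎 ⊎ y ≡ u
    q-onto : ∀ z → ∃ λ y → q y ≡ z

-- The first nonzero coordinate of the killed vector is the pivot: it is cleared by adding that
-- vector and then dropped.
kill : (u : F₂^ (suc w)) → u ≢ 𝟎 → Kill u
kill (true ∷ u) _ = record
  { q      = extend u id
  ; q-add  = extend-additive u (λ _ _ → refl)
  ; q-ker  = λ { (false ∷ y) eq → inj₁ (cong (false ∷_) eq)
               ; (true ∷ y) eq → inj₂ (cong (true ∷_) (sym (⊕≡𝟎⇒≡ eq))) }
  ; q-onto = λ z → false ∷ z , refl }
kill {zero} (false ∷ []) u≢𝟎 = contradiction refl u≢𝟎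
kill {suc w} (false ∷ u) u≢𝟎 = record
  { q      = λ { (b ∷ y) → b ∷ K.q y }
  ; q-add  = λ { (a ∷ x) (b ∷ y) → cong ((a xor b) ∷_) (K.q-add x y) }
  ; q-ker  = λ { (false ∷ y) eq → Sum.map (cong (false ∷_)) (cong (false ∷_))
                   (K.q-ker y (∷-injectiveʳ eq))
               ; (true ∷ y) () }
  ; q-onto = λ { (b ∷ z) → let y , eq = K.q-onto z in b ∷ y , cong (b ∷_) eq } }
  where module K = Kill (kill u (u≢𝟎 ∘ cong (false ∷_)))

-- The projection modulo the span of `P`; thus `w` is the codimension of that span.
record Quotient {n} (P : F₂^ n → Set) (w : ℕ) : Set where
  field
    π        : F₂^ n → F₂^ w
    π-add    : Additive π
    π-onto   : ∀ y → ∃ λ x → π x ≡ y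
    π-killed : ∀ x → P x → π x ≡ 𝟎
    π-ker    : ∀ x → π x ≡ 𝟎 → Span P x

-- Starting from the identity, factor out the image of some vector of `P` that is not yet killed.
-- Each round lowers the target dimension, so the process stops.
quotient : {P : F₂^ n → Set} → Decidable P → ∃ (Quotient P)
quotient {n} {P} P? = refine n id (λ _ _ → refl) (λ y → y , refl) λ x x≡𝟎 →
  subst (Span P) (sym x≡𝟎) 𝟎∈
  where
  refine : ∀ w (π : F₂^ n → F₂^ w) → Additive π → (∀ y → ∃ λ x → π x ≡ y) →
    (∀ x → π x ≡ 𝟎 → Span P x) → ∃ (Quotient P)
  refine w π add onto ker with search (λ x → P? x ×-dec ¬? (π x ≟ 𝟎))
  ... | no ∄ = w , record { π = π ; π-add = add ; π-onto = onto ; π-ker = ker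
      ; π-killed = λ x px → decidable-stable (π x ≟ 𝟎) λ πx≢𝟎 → ∄ (x , px , πx≢𝟎) }
  refine zero π add onto ker | yes (x₀ , _ , πx₀≢𝟎) with π x₀
  ... | [] = contradiction refl πx₀≢𝟎
  refine (suc w) π add onto ker | yes (x₀ , px₀ , πx₀≢𝟎) = refine w (q ∘ π)
    (λ x y → trans (cong q (add x y)) (q-add _ _))
    (λ z → let y , qy≡z = q-onto z ; x , πx≡y = onto y in x , trans (cong q πx≡y) qy≡z)
    λ x → lemma x ∘ q-ker (π x)
    where
    open Kill (kill (π x₀) πx₀≢𝟎)
    lemma : ∀ x → π x ≡ 𝟎 ⊎ π x ≡ π x₀ → Span P x
    lemma x (inj₁ πx≡𝟎)   = ker x πx≡𝟎
    lemma x (inj₂ πx≡πx₀) = subst (Span P) (⊕-cancelˡ x₀ x) (add∈ px₀ (ker (x₀ ⊕ x)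
      (trans (add x₀ x) (trans (cong (π x₀ ⊕_) πx≡πx₀) (⊕-same _)))))

-- Some colour class does not span

-- A form of rainbow-freeness that is symmetric in the colours.
TriangleFree : Colouring n → Set
TriangleFree c = ∀ x y → x ≢ 𝟎 → y ≢ 𝟎 → x ≢ y →
  c x ≢ c y → c y ≢ c (x ⊕ y) → c x ≢ c (x ⊕ y) → ⊥

line : (x y : F₂^ n) → x ≢ 𝟎 → y ≢ 𝟎 → x ≢ y → Embedding 2 n
line x y x≢𝟎 y≢𝟎 x≢y = embedding (extend x (extend y (const 𝟎)))
  (extend-additive x (extend-additive y (λ _ _ → sym (⊕-same 𝟎)))) λ
  { (false ∷ false ∷ []) eq → refl
  ; (false ∷ true  ∷ []) eq → contradiction (⊕≡𝟎⇒≡ eq) y≢𝟎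
  ; (true  ∷ false ∷ []) eq → contradiction (⊕≡𝟎⇒≡ eq) x≢𝟎
  ; (true  ∷ true  ∷ []) eq → contradiction (trans (⊕≡𝟎⇒≡ eq) (⊕-identityʳ y)) x≢y }

-- Any two of `x`, `y`, `z` span the same line, so in whichever order the colours come, some ordered
-- pair of points gives the embedding that `rainbow` prescribes.
free⇒triangleFree : (c : Colouring n) → Free c rainbow → TriangleFree c
free⇒triangleFree {n} c free x y x≢𝟎 y≢𝟎 x≢y = permute _ _ _ refl refl refl
  where
  z = x ⊕ y
  z≢𝟎 : z ≢ 𝟎
  z≢𝟎 = x≢y ∘ ⊕≡𝟎⇒≡
  x≢z : x ≢ z
  x≢z eq = y≢𝟎 (trans (sym (⊕-cancelˡ x y)) (trans (cong (x ⊕_) (sym eq)) (⊕-same x)))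
  y≢z : y ≢ z
  y≢z eq = x≢𝟎 (trans (sym (⊕-cancelʳ x y)) (trans (cong (_⊕ y) (sym eq)) (⊕-same y)))
  x⊕z : x ⊕ z ≡ y
  x⊕z = ⊕-cancelˡ x y
  z⊕y : z ⊕ y ≡ x
  z⊕y = ⊕-cancelʳ x y

  hit : ∀ u v → u ≢ 𝟎 → v ≢ 𝟎 → u ≢ v → c u ≡ 0F → c v ≡ 1F → c (u ⊕ v) ≡ 2F → ⊥
  hit u v u≢𝟎 v≢𝟎 u≢v cu cv cuv = free (line u v u≢𝟎 v≢𝟎 u≢v , λ
    { (false ∷ false ∷ []) ne → contradiction refl ne
    ; (false ∷ true  ∷ []) _  → trans (cong c (⊕-identityʳ v)) cv
    ; (true  ∷ false ∷ []) _  → trans (cong c (⊕-identityʳ u)) cu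
    ; (true  ∷ true  ∷ []) _  → trans (cong (λ t → c (u ⊕ t)) (⊕-identityʳ v)) cuv })

  permute : ∀ i j k → c x ≡ i → c y ≡ j → c z ≡ k → i ≢ j → j ≢ k → i ≢ k → ⊥
  permute 0F 1F 2F cx cy cz _ _ _ = hit x y x≢𝟎 y≢𝟎 x≢y cx cy cz
  permute 1F 0F 2F cx cy cz _ _ _ =
    hit y x y≢𝟎 x≢𝟎 (x≢y ∘ sym) cy cx (trans (cong c (⊕-comm y x)) cz)
  permute 0F 2F 1F cx cy cz _ _ _ = hit x z x≢𝟎 z≢𝟎 x≢z cx cz (trans (cong c x⊕z) cy)
  permute 2F 0F 1F cx cy cz _ _ _ =
    hit y z y≢𝟎 z≢𝟎 y≢z cy cz (trans (cong c (trans (⊕-comm y z) z⊕y)) cx)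
  permute 1F 2F 0F cx cy cz _ _ _ =
    hit z x z≢𝟎 x≢𝟎 (x≢z ∘ sym) cz cx (trans (cong c (trans (⊕-comm z x) x⊕z)) cy)
  permute 2F 1F 0F cx cy cz _ _ _ = hit z y z≢𝟎 y≢𝟎 (y≢z ∘ sym) cz cy (trans (cong c z⊕y) cx)
  permute 0F 0F _ _ _ _ i≢j _ _ = i≢j refl
  permute 1F 1F _ _ _ _ i≢j _ _ = i≢j refl
  permute 2F 2F _ _ _ _ i≢j _ _ = i≢j refl
  permute 0F 1F 1F _ _ _ _ j≢k _ = j≢k refl
  permute 0F 2F 2F _ _ _ _ j≢k _ = j≢k refl
  permute 1F 0F 0F _ _ _ _ j≢k _ = j≢k refl
  permute 1F 2F 2F _ _ _ _ j≢k _ = j≢k refl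
  permute 2F 0F 0F _ _ _ _ j≢k _ = j≢k refl
  permute 2F 1F 1F _ _ _ _ j≢k _ = j≢k refl
  permute 0F 1F 0F _ _ _ _ _ i≢k = i≢k refl
  permute 0F 2F 0F _ _ _ _ _ i≢k = i≢k refl
  permute 1F 0F 1F _ _ _ _ _ i≢k = i≢k refl
  permute 1F 2F 1F _ _ _ _ _ i≢k = i≢k refl
  permute 2F 0F 2F _ _ _ _ _ i≢k = i≢k refl
  permute 2F 1F 2F _ _ _ _ _ i≢k = i≢k refl

triangleFree-∘ : (c : Colouring n) (e : Embedding k n) → TriangleFree c → TriangleFree (c ∘ fun e)
triangleFree-∘ c e tri x y x≢𝟎 y≢𝟎 x≢y rewrite Emb.add e x y =
  tri (fun e x) (fun e y) (x≢𝟎 ∘ Emb.ker e x) (y≢𝟎 ∘ Emb.ker e y) (x≢y ∘ Emb.injective e)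

-- The quotient H / F: N k x says that colour k occurs on the coset of F in r + H that lies over x,
-- and c̄ is the colouring of H / F, which avoids i.
module Core
  (i : Fin 3) (N : Fin 3 → F₂^ w → Set) (N? : ∀ k x → Dec (N k x))
  (cover : ∀ x → ∃ λ k → N k x) (c̄ : F₂^ w → Fin 3)
  (star : ∀ {k x a} → N k x → k ≢ i → N i a → x ≢ a → c̄ (x ⊕ a) ≡ k)
  (𝟎∈N : N i 𝟎) (spans : ∀ y → Span (N i) y) (v : F₂^ w) (v≢𝟎 : v ≢ 𝟎)
  where

  -- As `N i` spans the space, translations by its elements connect any two vectors.
  spread : {S : F₂^ w → Set} → (∀ {x a} → S x → N i a → S (x ⊕ a)) → ∀ {x} → S x → ∀ y → S y
  spread {S} closed {x} sx y =
    subst S (⊕-cancelˡ x y) (Span-absorb {S = S} closed sx (spans (x ⊕ y)))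

  -- Consequently, besides `i`, only the colour `c̄ x` can occur over a nonzero `x`.
  colour-at : ∀ {k x} → N k x → k ≢ i → x ≢ 𝟎 → c̄ x ≡ k
  colour-at {x = x} nx k≢i x≢𝟎 = trans (cong c̄ (sym (⊕-identityʳ x))) (star nx k≢i 𝟎∈N x≢𝟎)

  module _ {k l : Fin 3} (k≢i : k ≢ i) (l≢i : l ≢ i) (k≢l : k ≢ l) where

    -- If `k` occurred over 𝟎, `star` would give `c̄` the value `k` on all nonzero elements of
    -- `N i`. The nonzero vectors over which `l` occurs would then be closed under translation by
    -- `N i`, and `spread` would put 𝟎 among them.
    𝟎∉ : ∀ {b} → N l b → ¬ N k 𝟎
    𝟎∉ {b} nb n𝟎 = proj₂ (spread {λ x → N l x × x ≢ 𝟎} closed (nb , b≢𝟎) 𝟎) refl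
      where
      forced : ∀ {a} → N i a → a ≢ 𝟎 → c̄ a ≡ k
      forced {a} na a≢𝟎 = trans (cong c̄ (sym (⊕-identityˡ a))) (star n𝟎 k≢i na (a≢𝟎 ∘ sym))

      -- Were `b` zero, `c̄` would be both `k` and `l` on nonzero elements of `N i`; so `N i` would
      -- contain only 𝟎 and could not span `v`.
      b≢𝟎 : b ≢ 𝟎
      b≢𝟎 refl = v≢𝟎 (spread {_≡ 𝟎}
        (λ {x} {a} x≡𝟎 na → trans (cong₂ _⊕_ x≡𝟎 (a≡𝟎 na)) (⊕-same 𝟎)) refl v)
        where
        a≡𝟎 : ∀ {a} → N i a → a ≡ 𝟎
        a≡𝟎 {a} na = decidable-stable (a ≟ 𝟎) λ a≢𝟎 → k≢l (trans (sym (forced na a≢𝟎))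
          (trans (cong c̄ (sym (⊕-identityˡ a))) (star nb l≢i na (a≢𝟎 ∘ sym))))

      closed : ∀ {x a} → N l x × x ≢ 𝟎 → N i a → N l (x ⊕ a) × (x ⊕ a) ≢ 𝟎
      closed {x} {a} (nx , x≢𝟎) na = case (cover (x ⊕ a)) , xa≢𝟎
        where
        x≢a : x ≢ a
        x≢a refl = k≢l (trans (sym (forced na x≢𝟎)) (colour-at nx l≢i x≢𝟎))
        xa≢𝟎 : (x ⊕ a) ≢ 𝟎
        xa≢𝟎 = x≢a ∘ ⊕≡𝟎⇒≡
        cxa : c̄ (x ⊕ a) ≡ l
        cxa = star nx l≢i na x≢a
        case : (∃ λ m → N m (x ⊕ a)) → N l (x ⊕ a)
        case (m , nm) with m Fin.≟ i
        ... | yes refl = contradiction (trans (sym (forced nm xa≢𝟎)) cxa) k≢l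
        ... | no m≢i   = subst (λ t → N t (x ⊕ a)) (trans (sym (colour-at nm m≢i xa≢𝟎)) cxa) nm

  -- Since `g` is a sum of two elements of `N i`, a move by `g` can be made by two applications of
  -- `star`.
  Good : Fin 3 → F₂^ w → Set
  Good k g = N k g × ∃ λ a → N i a × N i (g ⊕ a)

  module _ {k l : Fin 3} (k≢i : k ≢ i) (l≢i : l ≢ i) (k≢l : k ≢ l) where

    -- Otherwise `N k` would be closed under translation by `N i`: if `i` occurs over `x ⊕ a`, then
    -- `x` is the sum of `a` and `x ⊕ a`, hence good. So `k` would occur over 𝟎, against `𝟎∉`.
    good-exists : ∀ {x b} → N k x → N l b → ∃ (Good k)
    good-exists nx nb
      with search (λ g → N? k g ×-dec search (λ a → N? i a ×-dec N? i (g ⊕ a)))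
    ... | yes g = g
    ... | no ∄  = contradiction (spread {N k} closed nx 𝟎) (𝟎∉ k≢i l≢i k≢l nb)
      where
      closed : ∀ {x a} → N k x → N i a → N k (x ⊕ a)
      closed {x} {a} nx na = case (cover (x ⊕ a))
        where
        x≢a : x ≢ a
        x≢a refl = ∄ (x , nx , x , na , subst (N i) (sym (⊕-same x)) 𝟎∈N)
        cxa : c̄ (x ⊕ a) ≡ k
        cxa = star nx k≢i na x≢a
        case : (∃ λ m → N m (x ⊕ a)) → N k (x ⊕ a)
        case (m , nm) with m Fin.≟ i
        ... | yes refl = contradiction (x , nx , a , na , nm) ∄
        ... | no m≢i   = subst (λ t → N t (x ⊕ a))
          (trans (sym (colour-at nm m≢i (x≢a ∘ ⊕≡𝟎⇒≡))) cxa) nm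

    -- If `a` is 𝟎 or `g`, then `g` itself lies in `N i`. Otherwise move from `b` first by `a`, then
    -- by `g ⊕ a`. Should `i` occur over the intermediate `b ⊕ a`, then `star` would give
    -- `b ⊕ g ⊕ a` colour `k` starting from `g` and colour `l` starting from `b`.
    good-dominated : ∀ {g b} → Good k g → N l b → c̄ (b ⊕ g) ≡ l
    good-dominated {g} {b} (ng , a , na , na′) nb = cases (a ≟ 𝟎) (g ≟ a)
      where
      clash : ∀ {x} → c̄ x ≡ k → c̄ x ≡ l → ⊥
      clash p q = k≢l (trans (sym p) q)
      cg : c̄ g ≡ k
      cg = colour-at ng k≢i λ { refl → 𝟎∉ k≢i l≢i k≢l nb ng }
      cb : c̄ b ≡ l
      cb = colour-at nb l≢i λ { refl → 𝟎∉ l≢i k≢i (k≢l ∘ sym) ng nb }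
      b≢ : ∀ {x} → c̄ x ≡ k → b ≢ x
      b≢ cx refl = clash cx cb

      cases : Dec (a ≡ 𝟎) → Dec (g ≡ a) → c̄ (b ⊕ g) ≡ l
      cases (yes refl) _ = star nb l≢i (subst (N i) (⊕-identityʳ g) na′) (b≢ cg)
      cases (no _) (yes refl) = star nb l≢i na (b≢ cg)
      cases (no a≢𝟎) (no g≢a) = case (cover (b ⊕ a))
        where
        ca′ : c̄ (g ⊕ a) ≡ k
        ca′ = star ng k≢i na g≢a
        ca : c̄ a ≡ k
        ca = trans (cong c̄ (sym (⊕-cancelˡ g a))) (star ng k≢i na′ λ eq →
          a≢𝟎 (trans (sym (⊕-cancelˡ g a)) (trans (cong (g ⊕_) (sym eq)) (⊕-same g))))
        cba : c̄ (b ⊕ a) ≡ l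
        cba = star nb l≢i na (b≢ ca)
        ba≢𝟎 : (b ⊕ a) ≢ 𝟎
        ba≢𝟎 = b≢ ca ∘ ⊕≡𝟎⇒≡
        swap : g ⊕ (b ⊕ a) ≡ b ⊕ (g ⊕ a)
        swap = trans (sym (⊕-assoc g b a)) (trans (cong (_⊕ a) (⊕-comm g b)) (⊕-assoc b g a))
        regroup : (b ⊕ a) ⊕ (g ⊕ a) ≡ b ⊕ g
        regroup = trans (⊕-interchange b a g a)
          (trans (cong ((b ⊕ g) ⊕_) (⊕-same a)) (⊕-identityʳ _))
        case : (∃ λ m → N m (b ⊕ a)) → c̄ (b ⊕ g) ≡ l
        case (m , nm) with m Fin.≟ i
        ... | yes refl = contradiction (trans (cong c̄ (sym swap)) (star ng k≢i nm
                λ { refl → clash cg cba }))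
                λ p → clash p (star nb l≢i na′ (b≢ ca′))
        ... | no m≢i   = trans (cong c̄ (sym regroup)) (star
                (subst (λ t → N t (b ⊕ a)) (trans (sym (colour-at nm m≢i ba≢𝟎)) cba) nm)
                l≢i na′ λ eq → clash ca′ (trans (cong c̄ (sym eq)) cba))

  -- A good `g` for `k` and a good `h` for `l` dominate each other, so `c̄ (g ⊕ h)` would be both
  -- `k` and `l`.
  impossible : ∀ {k l x y} → k ≢ i → l ≢ i → k ≢ l → N k x → N l y → ⊥
  impossible k≢i l≢i k≢l nx ny =
    let g , goodg = good-exists k≢i l≢i k≢l nx ny
        h , goodh = good-exists l≢i k≢i (k≢l ∘ sym) ny nx
    in k≢l (trans (sym (good-dominated l≢i k≢i (k≢l ∘ sym) goodh (proj₁ goodg)))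
         (trans (cong c̄ (⊕-comm g h)) (good-dominated k≢i l≢i k≢l goodg (proj₁ goodh))))

Class : Colouring n → Fin 3 → F₂^ n → Set
Class c i x = x ≢ 𝟎 × c x ≡ i

other-colours : (i : Fin 3) → ∃₂ λ k l → k ≢ i × l ≢ i × k ≢ l
other-colours 0F = 1F , 2F , (λ ()) , (λ ()) , λ ()
other-colours 1F = 0F , 2F , (λ ()) , (λ ()) , λ ()
other-colours 2F = 0F , 1F , (λ ()) , (λ ()) , λ ()

NonSpanning : Colouring n → Set
NonSpanning c = ∃₂ λ i w → Quotient (Class c i) (suc w)

-- Vectors with first coordinate `false` form a hyperplane, so generators inside it cannot produce
-- `true ∷ 𝟎`.
Span-outside : (c : Colouring (suc n)) (k : Fin 3) → Span (Class c k) (true ∷ 𝟎) →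
  ∃ λ h → c (true ∷ h) ≡ k
Span-outside c k sp with search (λ h → c (true ∷ h) Fin.≟ k)
... | yes found = found
... | no ∄ = contradiction (inside sp) λ ()
  where
  inside : ∀ {x} → Span (Class c k) x → head x ≡ false
  inside 𝟎∈ = refl
  inside (add∈ {false ∷ _} {_ ∷ _} _ sy) = inside sy
  inside (add∈ {true ∷ h} (_ , ch) _) = contradiction (h , ch) ∄

-- Here H consists of the vectors `false ∷ h`, F is the kernel of `π`, and `true ∷ r` is a point of
-- colour `i` outside H.
spanning-step : (c : Colouring (suc n)) → TriangleFree c →
  (∀ k y → Span (Class c k) y) → NonSpanning (c ∘ (false ∷_)) → ⊥
spanning-step {n} c tri spans (i , w , Q) =
  let k , l , k≢i , l≢i , k≢l = other-colours i
  in Core.impossible i N N? cover c̄ star 𝟎∈N N-spans (true ∷ 𝟎) (λ ()) k≢i l≢i k≢l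
       (N-outside (proj₂ (outside k))) (N-outside (proj₂ (outside l)))
  where
  open Quotient Q
  cH : Colouring n
  cH = c ∘ (false ∷_)

  outside : ∀ k → ∃ λ h → c (true ∷ h) ≡ k
  outside k = Span-outside c k (spans k (true ∷ 𝟎))

  r : F₂^ n
  r = proj₁ (outside i)

  N : Fin 3 → F₂^ (suc w) → Set
  N k y = ∃ λ h → π h ≡ y × c (true ∷ (r ⊕ h)) ≡ k

  N? : ∀ k y → Dec (N k y)
  N? k y = search λ h → (π h ≟ y) ×-dec (c (true ∷ (r ⊕ h)) Fin.≟ k)

  cover : ∀ y → ∃ λ k → N k y
  cover y = let h , πh≡y = π-onto y in _ , h , πh≡y , refl

  -- The colour of a chosen preimage. Away from 𝟎 the choice is immaterial by `cH≡c̄`; at 𝟎 the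
  -- value is arbitrary.
  c̄ : F₂^ (suc w) → Fin 3
  c̄ y = cH (proj₁ (π-onto y))

  𝟎∈N : N i 𝟎
  𝟎∈N = 𝟎 , additive-𝟎 π-add ,
    trans (cong (c ∘ (true ∷_)) (⊕-identityʳ r)) (proj₂ (outside i))

  N-outside : ∀ {k h} → c (true ∷ h) ≡ k → N k (π r ⊕ π h)
  N-outside {h = h} eq = r ⊕ h , π-add r h , trans (cong (c ∘ (true ∷_)) (⊕-cancelˡ r h)) eq

  -- Extending `π` by `true ∷ 𝟎` ↦ `π r` kills both F and `true ∷ r`. It maps the spanning class `i`
  -- into `N i` and 𝟎, and its image is all of H / F.
  N-spans : ∀ y → Span (N i) y
  N-spans y = let h , πh≡y = π-onto y in subst (Span (N i)) πh≡y
    (Span-map (extend-additive (π r) π-add) image (spans i (false ∷ h)))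
    where
    image : ∀ x → Class c i x → extend (π r) π x ≡ 𝟎 ⊎ N i (extend (π r) π x)
    image (false ∷ h) (h≢𝟎 , ch) = inj₁ (π-killed h (h≢𝟎 ∘ cong (false ∷_) , ch))
    image (true  ∷ h) (_ , ch)   = inj₂ (N-outside ch)

  cH≢i : ∀ {x} → π x ≢ 𝟎 → cH x ≢ i
  cH≢i {x} πx≢𝟎 cx = πx≢𝟎 (π-killed x ((λ { refl → πx≢𝟎 (additive-𝟎 π-add) }) , cx))

  -- Within H, colour `i` occurs only in F, so neither `x` nor `x ⊕ p` has it. As `p` does, the line
  -- is rainbow unless those two agree.
  cH-invariant : ∀ {x p} → π x ≢ 𝟎 → π p ≡ 𝟎 → Class cH i p → cH (x ⊕ p) ≡ cH x
  cH-invariant {x} {p} πx≢𝟎 πp≡𝟎 (p≢𝟎 , cp) = decidable-stable (_ Fin.≟ _) λ ne →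
    tri (false ∷ x) (false ∷ p) (λ { refl → πx≢𝟎 (additive-𝟎 π-add) }) (p≢𝟎 ∘ ∷-injectiveʳ)
      (λ { refl → πx≢𝟎 πp≡𝟎 })
      (λ eq → cH≢i πx≢𝟎 (trans eq cp))
      (λ eq → cH≢i (λ e → πx≢𝟎 (trans (sym πxp) e)) (trans (sym eq) cp))
      (ne ∘ sym)
    where
    πxp : π (x ⊕ p) ≡ π x
    πxp = trans (π-add x p) (trans (cong (π x ⊕_) πp≡𝟎) (⊕-identityʳ _))

  cH≡c̄ : ∀ {x} → π x ≢ 𝟎 → cH x ≡ c̄ (π x)
  cH≡c̄ {x} πx≢𝟎 = sym (trans (cong cH (sym (⊕-cancelˡ x y))) (proj₂
    -- Walk to the chosen preimage by generators of F; carrying `π z ≡ π x` along keeps the walk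
    -- outside F, where `cH-invariant` applies.
    (Span-absorb {S = λ z → π z ≡ π x × cH z ≡ cH x} closed (refl , refl)
      (π-ker (x ⊕ y) (trans (π-add x y) (trans (cong (π x ⊕_) πy≡πx) (⊕-same _)))))))
    where
    y = proj₁ (π-onto (π x))
    πy≡πx = proj₂ (π-onto (π x))
    closed : ∀ {z p} → π z ≡ π x × cH z ≡ cH x → Class cH i p → π (z ⊕ p) ≡ π x × cH (z ⊕ p) ≡ cH x
    closed {z} {p} (πz , cz) pc =
      trans (π-add z p) (trans (cong₂ _⊕_ πz πp) (⊕-identityʳ _)) ,
      trans (cH-invariant (πx≢𝟎 ∘ trans (sym πz)) πp pc) cz
      where πp = π-killed p pc

  -- A point of colour `k` over `x` and one of colour `i` over `a`, both outside H, sum to a point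
  -- of H over `x ⊕ a`. That point is outside F, so its colour is not `i`, and the line through them
  -- leaves only `k`.
  star : ∀ {k x a} → N k x → k ≢ i → N i a → x ≢ a → c̄ (x ⊕ a) ≡ k
  star {k} {x} {a} (h , πh , ch) k≢i (h′ , πh′ , ch′) x≢a =
    trans (cong c̄ (sym πs)) (trans (sym (cH≡c̄ πs≢𝟎))
      (decidable-stable (_ Fin.≟ _) λ ne →
        tri (false ∷ s) (true ∷ (r ⊕ h′))
          (λ eq → πs≢𝟎 (trans (cong π (∷-injectiveʳ eq)) (additive-𝟎 π-add))) (λ ()) (λ ())
          (λ eq → cH≢i πs≢𝟎 (trans eq ch′))
          (λ eq → k≢i (trans (sym third) (trans (sym eq) ch′)))
          (λ eq → ne (trans eq third))))
    where
    s = h ⊕ h′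
    πs : π s ≡ x ⊕ a
    πs = trans (π-add h h′) (cong₂ _⊕_ πh πh′)
    πs≢𝟎 : π s ≢ 𝟎
    πs≢𝟎 eq = x≢a (⊕≡𝟎⇒≡ (trans (sym πs) eq))
    third : c (true ∷ (s ⊕ (r ⊕ h′))) ≡ k
    third = trans (cong (c ∘ (true ∷_)) (begin
      (h ⊕ h′) ⊕ (r ⊕ h′)  ≡⟨ ⊕-interchange h h′ r h′ ⟩
      (h ⊕ r) ⊕ (h′ ⊕ h′)  ≡⟨ cong₂ _⊕_ (⊕-comm h r) (⊕-same h′) ⟩
      (r ⊕ h) ⊕ 𝟎          ≡⟨ ⊕-identityʳ _ ⟩
      r ⊕ h                ∎)) ch
      where open ≡-Reasoning

-- If all classes spanned, induction on a hyperplane would supply the input of `spanning-step`; in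
-- dimension 1 the single point cannot carry two colours.
nonSpanning : (c : Colouring (suc n)) → TriangleFree c → NonSpanning c
nonSpanning {n} c tri = dichotomy (class 0F) (class 1F) (class 2F)
  where
  class : ∀ k → ∃ (Quotient (Class c k))
  class k = quotient λ x → ¬? (x ≟ 𝟎) ×-dec (c x Fin.≟ k)

  all-span : ∀ k → Quotient (Class c k) 0 → ∀ y → Span (Class c k) y
  all-span k Q y with Quotient.π Q y in eq
  ... | [] = Quotient.π-ker Q y eq

  contra : ∀ n (c : Colouring (suc n)) → TriangleFree c → (∀ k y → Span (Class c k) y) → ⊥
  contra zero c tri spans
    with [] , c≡0 ← Span-outside c 0F (spans 0F _) | [] , c≡1 ← Span-outside c 1F (spans 1F _)
    with () ← trans (sym c≡0) c≡1
  contra (suc n) c tri spans = spanning-step c tri spans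
    (nonSpanning (c ∘ (false ∷_)) (triangleFree-∘ c cons-false tri))

  dichotomy : ∃ (Quotient (Class c 0F)) → ∃ (Quotient (Class c 1F)) → ∃ (Quotient (Class c 2F)) →
    NonSpanning c
  dichotomy (suc w , Q) _ _ = 0F , w , Q
  dichotomy _ (suc w , Q) _ = 1F , w , Q
  dichotomy _ _ (suc w , Q) = 2F , w , Q
  dichotomy (zero , Q₀) (zero , Q₁) (zero , Q₂) = contradiction
    (λ { 0F → all-span 0F Q₀ ; 1F → all-span 1F Q₁ ; 2F → all-span 2F Q₂ }) (contra n c tri)

-- Coordinate blocks

take-additive : ∀ a {b} → Additive (take a {b})
take-additive a x y = take-zipWith {m = a} _xor_ x y

drop-additive : ∀ a {b} → Additive (drop a {b})
drop-additive a x y = drop-zipWith {m = a} _xor_ x y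

take-drop-𝟎 : ∀ a {b} (x : F₂^ (a ℕ.+ b)) → take a x ≡ 𝟎 → drop a x ≡ 𝟎 → x ≡ 𝟎
take-drop-𝟎 zero    x       _  eq = eq
take-drop-𝟎 (suc a) (b ∷ x) eq eq′ =
  cong₂ _∷_ (cong head eq) (take-drop-𝟎 a x (∷-injectiveʳ eq) eq′)

-- Subspaces avoiding a colour

Avoiding : Colouring n → Fin 3 → ℕ → Set
Avoiding {n} c i d = Σ (Embedding d n) λ V → AvoidsColour c V i

avoiding-∘ : (c : Colouring n) (e : Embedding k n) {i : Fin 3} →
  Avoiding (c ∘ fun e) i d → Avoiding c i d
avoiding-∘ c e (V , av) = e ∘ₑ V , av

-- All points of colour `i` lie in the kernel of `π`, so adding a complement of the kernel to a
-- subspace of the kernel brings in none.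
avoiding-join : (c : Colouring n) (i : Fin 3) (π : F₂^ n → F₂^ m) → Additive π →
  (∀ x → Class c i x → π x ≡ 𝟎) → (S : Splitting π) →
  Avoiding (c ∘ fun (Splitting.κ S)) i d → Avoiding c i (Splitting.cdim S ℕ.+ d)
avoiding-join {n} {d = d} c i π π-add π-killed S (V , av) = J , J-avoids
  where
  open Splitting S
  W = κ ∘ₑ V
  ψ : F₂^ (cdim ℕ.+ d) → F₂^ n
  ψ x = fun ω (take cdim x) ⊕ fun W (drop cdim x)

  π-ψ : ∀ x → π (ψ x) ≡ π (fun ω (take cdim x))
  π-ψ x = trans (π-add _ _) (trans (cong (_ ⊕_) (κ-killed _)) (⊕-identityʳ _))

  ψ-below : ∀ x → π (ψ x) ≡ 𝟎 → take cdim x ≡ 𝟎 × ψ x ≡ fun W (drop cdim x)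
  ψ-below x eq = t≡𝟎 , trans (cong (λ t → fun ω t ⊕ fun W (drop cdim x)) t≡𝟎)
    (trans (cong (_⊕ _) (additive-𝟎 (Emb.add ω))) (⊕-identityˡ _))
    where t≡𝟎 = ω-ker _ (trans (sym (π-ψ x)) eq)

  J : Embedding (cdim ℕ.+ d) n
  J = embedding ψ
    (λ x y → trans (cong₂ _⊕_
        (trans (cong (fun ω) (take-additive cdim x y)) (Emb.add ω _ _))
        (trans (cong (fun W) (drop-additive cdim x y)) (Emb.add W _ _)))
      (⊕-interchange _ _ _ _))
    λ x eq → let t≡𝟎 , ψx = ψ-below x (trans (cong π eq) (additive-𝟎 π-add)) in
      take-drop-𝟎 cdim x t≡𝟎 (Emb.ker W _ (trans (sym ψx) eq))

  J-avoids : AvoidsColour c J i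
  J-avoids x x≢𝟎 cx = av (drop cdim x) (λ d≡𝟎 → x≢𝟎 (take-drop-𝟎 cdim x t≡𝟎 d≡𝟎))
    (trans (cong c (sym ψx)) cx)
    where
    below = ψ-below x (π-killed (ψ x) (x≢𝟎 ∘ Emb.ker J x , cx))
    t≡𝟎 = proj₁ below
    ψx  = proj₂ below

Decomposition : Colouring n → Set
Decomposition {n} c = ∃ λ d₀ → ∃₂ λ d₁ d₂ → d₀ ℕ.+ d₁ ℕ.+ d₂ ≡ n ×
  Avoiding c 0F d₀ × Avoiding c 1F d₁ × Avoiding c 2F d₂

-- Recursion on the span of a non-spanning class `i`, realised as the kernel of `π`: the subspace
-- avoiding `i` regains exactly the `cdim` lost dimensions, and the other two are kept.
decomposition : ∀ n (c : Colouring n) → TriangleFree c → Decomposition c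
decomposition = <-rec _ step
  where
  step : ∀ n → (∀ {m} → m ℕ.< n → (c : Colouring m) → TriangleFree c → Decomposition c) →
    (c : Colouring n) → TriangleFree c → Decomposition c
  step zero _ c tri = 0 , 0 , 0 , refl , trivial , trivial , trivial
    where
    trivial : ∀ {i} → Avoiding c i 0
    trivial = embedding id (λ _ _ → refl) (λ _ → id) , λ { [] x≢𝟎 → contradiction refl x≢𝟎 }
  step (suc n) rec c tri = combine i join (rec κdim<n (c ∘ fun κ) (triangleFree-∘ c κ tri))
    where
    NS = nonSpanning c tri
    i = proj₁ NS
    open Quotient (proj₂ (proj₂ NS))
    S = splitting π π-add
    open Splitting S

    F₂^0 : ∀ {w} → w ≡ 0 → (z : F₂^ w) → z ≡ 𝟎
    F₂^0 refl [] = refl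

    cdim≢0 : cdim ≢ 0
    cdim≢0 cdim≡0 =
      let x , πx≡y = π-onto (true ∷ 𝟎)
          z , eq   = ω-onto x
      in contradiction (trans (sym πx≡y) (trans (sym eq) (trans
           (cong (π ∘ fun ω) (F₂^0 cdim≡0 z))
           (trans (cong π (additive-𝟎 (Emb.add ω))) (additive-𝟎 π-add))))) λ ()

    κdim<n : kdim ℕ.< suc n
    κdim<n = subst (kdim ℕ.<_) dims (ℕ.m<m+n kdim (ℕ.n≢0⇒n>0 cdim≢0))

    join : ∀ {d} → Avoiding (c ∘ fun κ) i d → Avoiding c i (cdim ℕ.+ d)
    join = avoiding-join c i π π-add π-killed S

    total : ∀ {s} → s ≡ kdim → cdim ℕ.+ s ≡ suc n
    total refl = trans (ℕ.+-comm cdim kdim) dims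

    combine : ∀ i → (∀ {d} → Avoiding (c ∘ fun κ) i d → Avoiding c i (cdim ℕ.+ d)) →
      Decomposition (c ∘ fun κ) → Decomposition c
    combine 0F join (d₀ , d₁ , d₂ , eq , V₀ , V₁ , V₂) = cdim ℕ.+ d₀ , d₁ , d₂ ,
      trans (assoc₀ cdim d₀ d₁ d₂) (total eq) ,
      join V₀ , avoiding-∘ c κ V₁ , avoiding-∘ c κ V₂
      where
      assoc₀ : ∀ w a b c → w ℕ.+ a ℕ.+ b ℕ.+ c ≡ w ℕ.+ (a ℕ.+ b ℕ.+ c)
      assoc₀ = solve-∀
    combine 1F join (d₀ , d₁ , d₂ , eq , V₀ , V₁ , V₂) = d₀ , cdim ℕ.+ d₁ , d₂ ,
      trans (assoc₁ cdim d₀ d₁ d₂) (total eq) ,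
      avoiding-∘ c κ V₀ , join V₁ , avoiding-∘ c κ V₂
      where
      assoc₁ : ∀ w a b c → a ℕ.+ (w ℕ.+ b) ℕ.+ c ≡ w ℕ.+ (a ℕ.+ b ℕ.+ c)
      assoc₁ = solve-∀
    combine 2F join (d₀ , d₁ , d₂ , eq , V₀ , V₁ , V₂) = d₀ , d₁ , cdim ℕ.+ d₂ ,
      trans (assoc₂ cdim d₀ d₁ d₂) (total eq) ,
      avoiding-∘ c κ V₀ , avoiding-∘ c κ V₁ , join V₂
      where
      assoc₂ : ∀ w a b c → a ℕ.+ b ℕ.+ (w ℕ.+ c) ≡ w ℕ.+ (a ℕ.+ b ℕ.+ c)
      assoc₂ = solve-∀

avoiding-third : (n : ℕ) (c : Colouring n) → Free c rainbow →
  Σ ℕ λ d → Σ (Embedding d n) λ V → Σ (Fin 3) λ i → (3 ℕ.* d ≥ n) × AvoidsColour c V i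
avoiding-third n c free with decomposition n c (free⇒triangleFree c free)
... | d₀ , d₁ , d₂ , d≡n , (V₀ , av₀) , (V₁ , av₁) , (V₂ , av₂)
  with n ℕ.≤? 3 ℕ.* d₀ | n ℕ.≤? 3 ℕ.* d₁
... | yes n≤ | _      = d₀ , V₀ , 0F , n≤ , av₀
... | no _   | yes n≤ = d₁ , V₁ , 1F , n≤ , av₁
... | no n≰₀ | no n≰₁ = d₂ , V₂ , 2F , ℕ.≮⇒≥ too-small , av₂
  where
  triple : ∀ a b c → 3 ℕ.* a ℕ.+ 3 ℕ.* b ℕ.+ 3 ℕ.* c ≡
    (a ℕ.+ b ℕ.+ c) ℕ.+ (a ℕ.+ b ℕ.+ c) ℕ.+ (a ℕ.+ b ℕ.+ c)
  triple = solve-∀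
  too-small : ¬ 3 ℕ.* d₂ ℕ.< n
  too-small lt = ℕ.<-irrefl (trans (triple d₀ d₁ d₂) (cong (λ s → s ℕ.+ s ℕ.+ s) d≡n))
    (ℕ.+-mono-< (ℕ.+-mono-< (ℕ.≰⇒> n≰₀) (ℕ.≰⇒> n≰₁)) lt)

-- Generic two-colourings

-- A disjunction of literals: `just b` at a variable demands the value `b`, and `nothing` marks an
-- absent variable.
Clause : ℕ → Set
Clause vars = Fin vars → Maybe Bool

Sat : (Fin vars → Bool) → Clause vars → Set
Sat f C = ∃ λ j → C j ≡ just (f j)

-- 2 ^ vars times the probability that a uniformly random assignment falsifies the clause.
weight : Clause vars → ℕ
weight {zero}  C = 1
weight {suc vars} C = factor (C zero) ℕ.* weight (C ∘ suc)
  where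
  factor : Maybe Bool → ℕ
  factor (just _) = 1
  factor nothing  = 2

total : List (Clause vars) → ℕ
total = sum ∘ List.map weight

-- Once the variable has value `b`, the clause is still open unless its literal demands `b`; `xor`
-- tests the disagreement.
survives : Bool → Maybe Bool → Bool
survives b (just b′) = b xor b′
survives b nothing   = true

residual : Bool → List (Clause (suc vars)) → List (Clause vars)
residual b []       = []
residual b (C ∷ Cs) = if survives b (C zero) then C ∘ suc ∷ residual b Cs else residual b Cs

-- A falsification probability is the average over the two values of the first variable; the scaling
-- of `weight` turns the average into a sum.
residual-total : (Cs : List (Clause (suc vars))) →
  total (residual true Cs) ℕ.+ total (residual false Cs) ≡ total Cs
residual-total []       = refl
residual-total {vars} (C ∷ Cs) with C zero
... | just true  = trans (rearrange W T F) (cong (W ℕ.+ 0 ℕ.+_) (residual-total Cs))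
  where
  W = weight (C ∘ suc)
  T = total (residual true Cs)
  F = total (residual false Cs)
  rearrange : ∀ w t f → t ℕ.+ (w ℕ.+ f) ≡ w ℕ.+ 0 ℕ.+ (t ℕ.+ f)
  rearrange = solve-∀
... | just false = trans (rearrange W T F) (cong (W ℕ.+ 0 ℕ.+_) (residual-total Cs))
  where
  W = weight (C ∘ suc)
  T = total (residual true Cs)
  F = total (residual false Cs)
  rearrange : ∀ w t f → w ℕ.+ t ℕ.+ f ≡ w ℕ.+ 0 ℕ.+ (t ℕ.+ f)
  rearrange = solve-∀
... | nothing    = trans (rearrange W T F) (cong (W ℕ.+ (W ℕ.+ 0) ℕ.+_) (residual-total Cs))
  where
  W = weight (C ∘ suc)
  T = total (residual true Cs)
  F = total (residual false Cs)
  rearrange : ∀ w t f → w ℕ.+ t ℕ.+ (w ℕ.+ f) ≡ w ℕ.+ (w ℕ.+ 0) ℕ.+ (t ℕ.+ f)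
  rearrange = solve-∀

assign : Bool → (Fin vars → Bool) → Fin (suc vars) → Bool
assign b f zero    = b
assign b f (suc j) = f j

Sat-residual : ∀ b {f : Fin vars → Bool} (Cs : List (Clause (suc vars))) →
  All (Sat f) (residual b Cs) → All (Sat (assign b f)) Cs
Sat-residual b [] _ = []
Sat-residual b (C ∷ Cs) sat with C zero in eq
Sat-residual b (C ∷ Cs) ((j , p) ∷ sat) | nothing = (suc j , p) ∷ Sat-residual b Cs sat
Sat-residual true  (C ∷ Cs) sat | just true  = (zero , eq) ∷ Sat-residual true Cs sat
Sat-residual false (C ∷ Cs) sat | just false = (zero , eq) ∷ Sat-residual false Cs sat
Sat-residual true  (C ∷ Cs) ((j , p) ∷ sat) | just false = (suc j , p) ∷ Sat-residual true Cs sat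
Sat-residual false (C ∷ Cs) ((j , p) ∷ sat) | just true  = (suc j , p) ∷ Sat-residual false Cs sat

-- Method of conditional expectations.
satisfiable : ∀ vars (Cs : List (Clause vars)) → total Cs ℕ.< 2 ℕ.^ vars → ∃ λ f → All (Sat f) Cs
satisfiable zero    []      _  = (λ ()) , []
satisfiable zero    (_ ∷ _) (ℕ.s≤s ())
satisfiable (suc vars) Cs      lt with total (residual true Cs) ℕ.<? 2 ℕ.^ vars
... | yes ltᵗ = let f , sat = satisfiable vars _ ltᵗ in assign true f , Sat-residual true Cs sat
... | no ≮ᵗ   = let f , sat = satisfiable vars _ ltᶠ in assign false f , Sat-residual false Cs sat
  where
  ltᶠ : total (residual false Cs) ℕ.< 2 ℕ.^ vars
  ltᶠ = ℕ.≰⇒> λ ge → ℕ.<⇒≱ lt (begin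
    2 ℕ.^ vars ℕ.+ (2 ℕ.^ vars ℕ.+ 0)                          ≡⟨ cong (2 ℕ.^ vars ℕ.+_) (ℕ.+-identityʳ _) ⟩
    2 ℕ.^ vars ℕ.+ 2 ℕ.^ vars                                  ≤⟨ ℕ.+-mono-≤ (ℕ.≮⇒≥ ≮ᵗ) ge ⟩
    total (residual true Cs) ℕ.+ total (residual false Cs)  ≡⟨ residual-total Cs ⟩
    total Cs                                             ∎)
    where open ℕ.≤-Reasoning

width : Clause vars → ℕ
width {zero}  C = 0
width {suc vars} C with C zero
... | just _  = suc (width (C ∘ suc))
... | nothing = width (C ∘ suc)

weight-width : (C : Clause vars) → weight C ℕ.* 2 ℕ.^ width C ≡ 2 ℕ.^ vars
weight-width {zero}  C = refl
weight-width {suc vars} C with C zero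
... | just _  = trans (l (weight (C ∘ suc)) _) (cong (2 ℕ.*_) (weight-width (C ∘ suc)))
  where
  l : ∀ w p → (w ℕ.+ 0) ℕ.* (2 ℕ.* p) ≡ 2 ℕ.* (w ℕ.* p)
  l = solve-∀
... | nothing = trans (ℕ.*-assoc 2 (weight (C ∘ suc)) _) (cong (2 ℕ.*_) (weight-width (C ∘ suc)))

rank : (C : Clause vars) (j : Fin vars) → C j ≢ nothing → Fin (width C)
rank C zero    ne with C zero
... | just _  = zero
... | nothing = contradiction refl ne
rank C (suc j) ne with C zero
... | just _  = suc (rank (C ∘ suc) j ne)
... | nothing = rank (C ∘ suc) j ne

rank-injective : (C : Clause vars) (i j : Fin vars) (p : C i ≢ nothing) (q : C j ≢ nothing) →
  rank C i p ≡ rank C j q → i ≡ j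
rank-injective C zero zero p q eq = refl
rank-injective C zero (suc j) p q eq with C zero
... | nothing = contradiction refl p
rank-injective C zero (suc j) p q () | just _
rank-injective C (suc i) zero p q eq with C zero
... | nothing = contradiction refl q
rank-injective C (suc i) zero p q () | just _
rank-injective C (suc i) (suc j) p q eq with C zero
... | just _  = cong suc (rank-injective (C ∘ suc) i j p q (Fin.suc-injective eq))
... | nothing = cong suc (rank-injective (C ∘ suc) i j p q eq)

-- Falsified with probability at most 2 ^ -ℓ, denominators cleared.
Light : ℕ → Clause vars → Set
Light {vars} ℓ C = weight C ℕ.* 2 ℕ.^ ℓ ℕ.≤ 2 ℕ.^ vars

-- Each constrained variable halves the falsification probability; `rank` turns the ℓ distinct ones
-- into a lower bound on `width C`.
injective⇒light : (C : Clause vars) (h : Fin ℓ → Fin vars) → Injective _≡_ _≡_ h →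
  (∀ j → C (h j) ≢ nothing) → Light ℓ C
injective⇒light C h inj ne = ℕ.≤-trans
  (ℕ.*-monoʳ-≤ (weight C) (ℕ.^-monoʳ-≤ 2 (Fin.injective⇒≤
    {f = λ j → rank C (h j) (ne j)} (inj ∘ rank-injective C _ _ _ _))))
  (ℕ.≤-reflexive (weight-width C))

total-light : (Cs : List (Clause vars)) → All (Light ℓ) Cs →
  total Cs ℕ.* 2 ℕ.^ ℓ ℕ.≤ length Cs ℕ.* 2 ℕ.^ vars
total-light []       []        = ℕ.z≤n
total-light {ℓ = ℓ} (C ∷ Cs) (l ∷ ls) = ℕ.≤-trans
  (ℕ.≤-reflexive (ℕ.*-distribʳ-+ (2 ℕ.^ ℓ) (weight C) _)) (ℕ.+-mono-≤ l (total-light {ℓ = ℓ} Cs ls))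

combination : Vec (F₂^ n) k → F₂^ k → F₂^ n
combination []      _ = 𝟎
combination (v ∷ M)   = extend v (combination M)

columns : (F₂^ k → F₂^ n) → Vec (F₂^ n) k
columns {zero}  ψ = []
columns {suc k} ψ = ψ (true ∷ 𝟎) ∷ columns (ψ ∘ (false ∷_))

-- Values on a basis determine an additive map, so embeddings can be enumerated as matrices.
combination-columns : {ψ : F₂^ k → F₂^ n} → Additive ψ → ∀ x → combination (columns ψ) x ≡ ψ x
combination-columns add [] = sym (additive-𝟎 add)
combination-columns add (false ∷ x) =
  combination-columns (λ x y → add (false ∷ x) (false ∷ y)) x
combination-columns {ψ = ψ} add (true ∷ x) = trans
  (cong (ψ (true ∷ 𝟎) ⊕_) (combination-columns (λ x y → add (false ∷ x) (false ∷ y)) x))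
  (sym (true∷-additive add x))

-- On the affine half ψ(1,y) every point is nonzero, so a value of f is a colour there.
Evasive : ℕ → (F₂^ m → Bool) → Set
Evasive {m} t f = (e : Embedding (suc t) m) → ∀ b → ∃ λ y → f (fun e (true ∷ y)) ≡ b

literal : {A : Set} → Bool → Dec A → Maybe Bool
literal b (yes _) = just b
literal b (no _)  = nothing

literal-just : {A : Set} (A? : Dec A) → literal b A? ≡ just c → A × b ≡ c
literal-just (yes x) refl = x , refl

literal-defined : {A : Set} (A? : Dec A) → A → literal b A? ≢ nothing
literal-defined (no ¬x) x _ = ¬x x

module _ (m t : ℕ) where
  private
    module Pt  = Inverse (F₂^-↔ m)
    module Par = Inverse (F₂^-↔ t)
    Matrices = Vec-↔ (F₂^-↔ m) (suc t)
    module Mat = Inverse Matrices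

  half? : (M : Vec (F₂^ m) (suc t)) → ∀ x → Dec (∃ λ y → combination M (true ∷ y) ≡ x)
  half? M x = search λ y → combination M (true ∷ y) ≟ x

  clause : Bool → Vec (F₂^ m) (suc t) → Clause (2 ℕ.^ m)
  clause b M j = literal b (half? M (Pt.to j))

  -- Union bound over two values and all matrices: the affine half of an embedding has 2 ^ t points,
  -- so a random function misses a given value on it with probability 2 ^ -(2 ^ t).
  evasive-exists : 2 ℕ.* (2 ℕ.^ m) ℕ.^ suc t ℕ.< 2 ℕ.^ (2 ℕ.^ t) → ∃ λ f → Evasive {m} t f
  evasive-exists few = f , evasive
    where
    light? : Decidable (Light {2 ℕ.^ m} (2 ℕ.^ t))
    light? C = _ ℕ.≤? _

    clauses : Bool → List (Clause (2 ℕ.^ m))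
    clauses b = List.map (clause b ∘ Mat.to) (allFin _)

    candidates Cs : List (Clause (2 ℕ.^ m))
    candidates = clauses true List.++ clauses false
    -- Matrices of non-injective maps may give clauses with too few literals. The filter loses no
    -- embedding, whose clauses are always light.
    Cs = List.filter light? candidates

    clause∈ : ∀ b M → clause b M ∈ clauses b
    clause∈ b M = subst (λ M′ → clause b M′ ∈ clauses b) (Mat.strictlyInverseˡ M)
      (∈-map⁺ (clause b ∘ Mat.to) (∈-allFin (Mat.from M)))

    candidate∈ : ∀ b M → clause b M ∈ candidates
    candidate∈ true  M = ∈-++⁺ˡ (clause∈ true M)
    candidate∈ false M = ∈-++⁺ʳ (clauses true) (clause∈ false M)

    length-clauses : ∀ b → length (clauses b) ≡ (2 ℕ.^ m) ℕ.^ suc t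
    length-clauses b = trans (List.length-map (clause b ∘ Mat.to) (allFin _))
      (List.length-tabulate {n = (2 ℕ.^ m) ℕ.^ suc t} id)

    length-candidates : length candidates ≡ 2 ℕ.* (2 ℕ.^ m) ℕ.^ suc t
    length-candidates = trans (List.length-++ (clauses true))
      (cong₂ ℕ._+_ (length-clauses true) (trans (length-clauses false) (sym (ℕ.+-identityʳ _))))

    solution : ∃ λ g → All (Sat g) Cs
    solution = satisfiable (2 ℕ.^ m) Cs (ℕ.*-cancelʳ-< (2 ℕ.^ (2 ℕ.^ t)) _ _ (begin-strict
      total Cs ℕ.* 2 ℕ.^ (2 ℕ.^ t)
        ≤⟨ total-light {ℓ = 2 ℕ.^ t} Cs (all-filter light? candidates) ⟩
      length Cs ℕ.* 2 ℕ.^ (2 ℕ.^ m)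
        ≤⟨ ℕ.*-monoˡ-≤ _ (List.length-filter light? candidates) ⟩
      length candidates ℕ.* 2 ℕ.^ (2 ℕ.^ m)
        ≡⟨ cong (ℕ._* 2 ℕ.^ (2 ℕ.^ m)) length-candidates ⟩
      2 ℕ.* (2 ℕ.^ m) ℕ.^ suc t ℕ.* 2 ℕ.^ (2 ℕ.^ m)
        <⟨ ℕ.*-monoˡ-< (2 ℕ.^ (2 ℕ.^ m)) {{ℕ.m^n≢0 2 (2 ℕ.^ m)}} few ⟩
      2 ℕ.^ (2 ℕ.^ t) ℕ.* 2 ℕ.^ (2 ℕ.^ m)
        ≡⟨ ℕ.*-comm (2 ℕ.^ (2 ℕ.^ t)) _ ⟩
      2 ℕ.^ (2 ℕ.^ m) ℕ.* 2 ℕ.^ (2 ℕ.^ t)                ∎))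
      where open ℕ.≤-Reasoning

    g = proj₁ solution

    f : F₂^ m → Bool
    f = g ∘ Pt.from

    evasive : Evasive t f
    evasive e b = y , trans (cong f (trans (sym (combination-columns (Emb.add e) (true ∷ y))) y≡))
                            (trans (cong g (Pt.strictlyInverseʳ j)) (sym b≡))
      where
      M = columns (fun e)
      half = λ y → combination M (true ∷ y)
      h = λ k → Pt.from (half (Par.to k))

      h-injective : Injective _≡_ _≡_ h
      h-injective {x} {y} eq = Injection.injective (↔⇒↣ (F₂^-↔ t)) (∷-injectiveʳ (Emb.injective e
        (trans (sym (combination-columns (Emb.add e) (true ∷ Par.to x))) (trans
          (Injection.injective (↔⇒↣ (↔-sym (F₂^-↔ m))) eq)
          (combination-columns (Emb.add e) (true ∷ Par.to y))))))

      light : Light (2 ℕ.^ t) (clause b M)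
      light = injective⇒light (clause b M) h h-injective
        λ k → literal-defined (half? M (Pt.to (h k))) (Par.to k , sym (Pt.strictlyInverseˡ _))

      sat = All.lookup (proj₂ solution) (∈-filter⁺ light? (candidate∈ b M) light)
      j = proj₁ sat
      hit = literal-just (half? M (Pt.to j)) (proj₂ sat)
      y = proj₁ (proj₁ hit)
      y≡ : half y ≡ Pt.to j
      y≡ = proj₂ (proj₁ hit)
      b≡ : b ≡ g j
      b≡ = proj₂ hit

-- Stacked colourings

triangleFree⇒free : (c : Colouring n) → TriangleFree c → Free c rainbow
triangleFree⇒free c tri (e , agrees) = tri (fun e x) (fun e y)
  (λ eq → contradiction (Emb.ker e x eq) λ ())
  (λ eq → contradiction (Emb.ker e y eq) λ ())
  (λ eq → contradiction (Emb.injective e eq) λ ())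
  (λ eq → contradiction (trans (sym cx) (trans eq cy)) λ ())
  (λ eq → contradiction (trans (sym cy) (trans eq cxy)) λ ())
  (λ eq → contradiction (trans (sym cx) (trans eq cxy)) λ ())
  where
  x y : F₂^ 2
  x = true ∷ false ∷ []
  y = false ∷ true ∷ []
  cx : c (fun e x) ≡ 0F
  cx = agrees x λ ()
  cy : c (fun e y) ≡ 1F
  cy = agrees y λ ()
  cxy : c (fun e x ⊕ fun e y) ≡ 2F
  cxy = trans (cong c (sym (Emb.add e x y))) (agrees (x ⊕ y) λ ())

truncation : k ℕ.≤ d → Embedding k d
truncation {d = d} ℕ.z≤n = embedding (const 𝟎) (λ _ _ → sym (⊕-same 𝟎)) λ { [] _ → refl }
truncation (ℕ.s≤s k≤d) = embedding (extend (true ∷ 𝟎) (fun E))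
  (extend-additive _ (Emb.add E))
  λ { (false ∷ x) eq → cong (false ∷_) (Emb.ker E x eq) ; (true ∷ x) () }
  where E = cons-false ∘ₑ truncation k≤d

module Bit = Inverse Fin.2↔Bool

two-coloured : (F₂^ m → Bool) → Fin 3 → Colouring m
two-coloured f j x = punchIn j (Bit.from (f x))

two-coloured-triangleFree : (f : F₂^ m → Bool) (j : Fin 3) → TriangleFree (two-coloured f j)
two-coloured-triangleFree f j x y _ _ _ = pigeonhole (f x) (f y) (f (x ⊕ y))
  where
  col : Bool → Fin 3
  col b = punchIn j (Bit.from b)
  pigeonhole : ∀ b₁ b₂ b₃ → col b₁ ≢ col b₂ → col b₂ ≢ col b₃ → col b₁ ≢ col b₃ → ⊥
  pigeonhole true  true  _     ≢₁₂ _   _   = ≢₁₂ refl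
  pigeonhole false false _     ≢₁₂ _   _   = ≢₁₂ refl
  pigeonhole _     true  true  _   ≢₂₃ _   = ≢₂₃ refl
  pigeonhole _     false false _   ≢₂₃ _   = ≢₂₃ refl
  pigeonhole true  _     true  _   _   ≢₁₃ = ≢₁₃ refl
  pigeonhole false _     false _   _   ≢₁₃ = ≢₁₃ refl

-- A larger subspace would contain one of dimension `suc t`, on whose affine half evasiveness
-- realises both colours other than `j`, hence `i`.
two-coloured-avoiding : {f : F₂^ m → Bool} → Evasive t f → ∀ {i j} → j ≢ i →
  Avoiding (two-coloured f j) i d → d ℕ.≤ t
two-coloured-avoiding {f = f} evasive {i} {j} j≢i (V , av) = ℕ.≮⇒≥ λ t<d →
  let E = truncation t<d
      y , fy = evasive (V ∘ₑ E) (Bit.to (punchOut j≢i))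
  in av (fun E (true ∷ y)) (λ eq → contradiction (Emb.ker E _ eq) λ ())
       (trans (cong (punchIn j ∘ Bit.from) fy)
         (trans (cong (punchIn j) (Bit.strictlyInverseʳ _)) (Fin.punchIn-punchOut j≢i)))

module Lift {a b : ℕ} (c₁ : Colouring a) (c₂ : Colouring b) where

  lift : Colouring (a ℕ.+ b)
  lift x with take a x ≟ 𝟎
  ... | yes _ = c₂ (drop a x)
  ... | no _  = c₁ (take a x)

  lift-upper : ∀ x → take a x ≢ 𝟎 → lift x ≡ c₁ (take a x)
  lift-upper x ne with take a x ≟ 𝟎
  ... | yes eq = contradiction eq ne
  ... | no _   = refl

  lift-lower : ∀ x → take a x ≡ 𝟎 → lift x ≡ c₂ (drop a x)
  lift-lower x eq with take a x ≟ 𝟎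
  ... | yes _ = refl
  ... | no ne = contradiction eq ne

  -- A line lies in the second block, or projects to a line of the first, or has two points with the
  -- same nonzero first block and thus the same colour.
  lift-triangleFree : TriangleFree c₁ → TriangleFree c₂ → TriangleFree lift
  lift-triangleFree tri₁ tri₂ x y x≢𝟎 y≢𝟎 x≢y xy yz xz =
    cases (take a x ≟ 𝟎) (take a y ≟ 𝟎) (take a x ≟ take a y)
    where
    z = x ⊕ y
    tz = take-additive a x y
    cases : Dec (take a x ≡ 𝟎) → Dec (take a y ≡ 𝟎) → Dec (take a x ≡ take a y) → ⊥
    cases (yes tx) (yes ty) _ = tri₂ (drop a x) (drop a y)
      (x≢𝟎 ∘ take-drop-𝟎 a x tx) (y≢𝟎 ∘ take-drop-𝟎 a y ty)
      (λ eq → x≢y (⊕≡𝟎⇒≡ (take-drop-𝟎 a z tz≡𝟎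
        (trans (drop-additive a x y) (trans (cong (_⊕ drop a y) eq) (⊕-same _))))))
      (λ eq → xy (trans lx (trans eq (sym ly))))
      (λ eq → yz (trans ly (trans eq (sym lz))))
      (λ eq → xz (trans lx (trans eq (sym lz))))
      where
      tz≡𝟎 : take a z ≡ 𝟎
      tz≡𝟎 = trans tz (trans (cong₂ _⊕_ tx ty) (⊕-same _))
      lx = lift-lower x tx
      ly = lift-lower y ty
      lz : lift z ≡ c₂ (drop a x ⊕ drop a y)
      lz = trans (lift-lower z tz≡𝟎) (cong c₂ (drop-additive a x y))
    cases (yes tx) (no ty) _ = yz (trans (lift-upper y ty)
      (trans (cong c₁ (sym tz≡ty)) (sym (lift-upper z (ty ∘ trans (sym tz≡ty))))))
      where
      tz≡ty : take a z ≡ take a y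
      tz≡ty = trans tz (trans (cong (_⊕ take a y) tx) (⊕-identityˡ _))
    cases (no tx) (yes ty) _ = xz (trans (lift-upper x tx)
      (trans (cong c₁ (sym tz≡tx)) (sym (lift-upper z (tx ∘ trans (sym tz≡tx))))))
      where
      tz≡tx : take a z ≡ take a x
      tz≡tx = trans tz (trans (cong (take a x ⊕_) ty) (⊕-identityʳ _))
    cases (no tx) (no ty) (yes eq) =
      xy (trans (lift-upper x tx) (trans (cong c₁ eq) (sym (lift-upper y ty))))
    cases (no tx) (no ty) (no ne) = tri₁ (take a x) (take a y) tx ty ne
      (λ eq → xy (trans lx (trans eq (sym ly))))
      (λ eq → yz (trans ly (trans eq (sym lz))))
      (λ eq → xz (trans lx (trans eq (sym lz))))
      where
      lx = lift-upper x tx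
      ly = lift-upper y ty
      lz : lift z ≡ c₁ (take a x ⊕ take a y)
      lz = trans (lift-upper z (ne ∘ ⊕≡𝟎⇒≡ ∘ trans (sym tz))) (cong c₁ tz)

  -- Split `V` along the projection to the first block: a complement of the kernel embeds there, and
  -- the kernel lies in the second block.
  lift-avoiding : ∀ {i} → Avoiding lift i d →
    ∃₂ λ d₁ d₂ → d₁ ℕ.+ d₂ ≡ d × Avoiding c₁ i d₁ × Avoiding c₂ i d₂
  lift-avoiding {d} {i} (V , av) = cdim , kdim , trans (ℕ.+-comm cdim kdim) dims , upper , lower
    where
    π : F₂^ d → F₂^ a
    π = take a ∘ fun V
    open Splitting (splitting π λ x y → trans (cong (take a) (Emb.add V x y)) (take-additive a _ _))
    VΩ = V ∘ₑ ω
    VK = V ∘ₑ κ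
    upper : Avoiding c₁ i cdim
    upper = embedding (π ∘ fun ω)
      (λ x y → trans (cong (take a) (Emb.add VΩ x y)) (take-additive a _ _)) ω-ker ,
      λ x x≢𝟎 cx → av (fun ω x) (x≢𝟎 ∘ Emb.ker ω x)
        (trans (lift-upper _ (x≢𝟎 ∘ ω-ker x)) cx)
    lower : Avoiding c₂ i kdim
    lower = embedding (drop a ∘ fun VK)
      (λ x y → trans (cong (drop a) (Emb.add VK x y)) (drop-additive a _ _))
      (λ x eq → Emb.ker VK x (take-drop-𝟎 a _ (κ-killed x) eq)) ,
      λ x x≢𝟎 cx → av (fun κ x) (x≢𝟎 ∘ Emb.ker κ x)
        (trans (lift-lower _ (κ-killed x)) cx)

open Lift

module _ {m t : ℕ} (f : F₂^ m → Bool) (evasive : Evasive t f) where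

  private
    block : Fin 3 → Colouring m
    block = two-coloured f

    block-triangleFree : ∀ j → TriangleFree (block j)
    block-triangleFree = two-coloured-triangleFree f

  three-blocks : Colouring (m ℕ.+ (m ℕ.+ m))
  three-blocks = lift (block 0F) (lift (block 1F) (block 2F))

  three-blocks-triangleFree : TriangleFree three-blocks
  three-blocks-triangleFree = lift-triangleFree (block 0F) (lift (block 1F) (block 2F))
    (block-triangleFree 0F)
    (lift-triangleFree (block 1F) (block 2F) (block-triangleFree 1F) (block-triangleFree 2F))

  -- Block `i` does not use colour `i` and may contribute all `m` dimensions; evasiveness limits
  -- each other block to `t`.
  three-blocks-avoiding : ∀ i → Avoiding three-blocks i d → d ℕ.≤ m ℕ.+ (t ℕ.+ t)
  three-blocks-avoiding i W
    with d₀ , d₁₂ , refl , V₀ , V₁₂ ← lift-avoiding (block 0F) (lift (block 1F) (block 2F)) W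
    with d₁ , d₂ , refl , V₁ , V₂ ← lift-avoiding (block 1F) (block 2F) V₁₂ = bound i V₀ V₁ V₂
    where
    large : ∀ {d i} j → Avoiding (block j) i d → d ℕ.≤ m
    large j (V , _) = injective⇒≤ (fun V) (Emb.injective V)
    small : ∀ {d i} j → j ≢ i → Avoiding (block j) i d → d ℕ.≤ t
    small j = two-coloured-avoiding {f = f} evasive
    bound : ∀ i {d₀ d₁ d₂} → Avoiding (block 0F) i d₀ → Avoiding (block 1F) i d₁ →
      Avoiding (block 2F) i d₂ → d₀ ℕ.+ (d₁ ℕ.+ d₂) ℕ.≤ m ℕ.+ (t ℕ.+ t)
    bound 0F V₀ V₁ V₂ =
      ℕ.+-mono-≤ (large 0F V₀) (ℕ.+-mono-≤ (small 1F (λ ()) V₁) (small 2F (λ ()) V₂))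
    bound 1F V₀ V₁ V₂ = ℕ.≤-trans
      (ℕ.+-mono-≤ (small 0F (λ ()) V₀) (ℕ.+-mono-≤ (large 1F V₁) (small 2F (λ ()) V₂)))
      (ℕ.≤-reflexive (rearrange m t))
      where
      rearrange : ∀ m t → t ℕ.+ (m ℕ.+ t) ≡ m ℕ.+ (t ℕ.+ t)
      rearrange = solve-∀
    bound 2F V₀ V₁ V₂ = ℕ.≤-trans
      (ℕ.+-mono-≤ (small 0F (λ ()) V₀) (ℕ.+-mono-≤ (small 1F (λ ()) V₁) (large 2F V₂)))
      (ℕ.≤-reflexive (rearrange m t))
      where
      rearrange : ∀ m t → t ℕ.+ (t ℕ.+ m) ≡ m ℕ.+ (t ℕ.+ t)
      rearrange = solve-∀

-- Parameters of the extremal colourings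

n<2^n : ∀ n → n ℕ.< 2 ℕ.^ n
n<2^n zero    = ℕ.s≤s ℕ.z≤n
n<2^n (suc n) = ℕ.≤-trans (ℕ.+-mono-≤ (ℕ.m^n>0 2 n) (n<2^n n))
  (ℕ.≤-reflexive (cong (2 ℕ.^ n ℕ.+_) (sym (ℕ.+-identityʳ _))))

-- For m = 2tB + 1, (m + 2t)B + 1 = m(B + 1), so (m + 2t) / 3m lies below (B + 1) / 3B, and hence
-- below every fraction with denominator B that exceeds 1/3.
block-dim : ℕ → ℕ → ℕ
block-dim B t = suc (2 ℕ.* t ℕ.* B)

-- With u = 18B + 2 and t = 3u the left side is cubic in B and 2 ^ t ≥ (u + 1) ^ 3.
enough-room : ∀ B → ∃ λ t → suc (block-dim B t ℕ.* suc t) ℕ.< 2 ℕ.^ t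
enough-room B = u ℕ.* 3 , (begin
  suc (suc (block-dim B (u ℕ.* 3) ℕ.* suc (u ℕ.* 3)))  ≤⟨ ℕ.m≤m+n _ _ ⟩
  suc (suc (block-dim B (u ℕ.* 3) ℕ.* suc (u ℕ.* 3))) ℕ.+ (1512 ℕ.* B ℕ.* B ℕ.+ 348 ℕ.* B ℕ.+ 18)
                                                       ≡⟨ cubes B ⟩
  suc u ℕ.* (suc u ℕ.* (suc u ℕ.* 1))                  ≤⟨ ℕ.^-monoˡ-≤ 3 (n<2^n u) ⟩
  (2 ℕ.^ u) ℕ.^ 3                                      ≡⟨ ℕ.^-*-assoc 2 u 3 ⟩
  2 ℕ.^ (u ℕ.* 3)                                      ∎)
  where
  open ℕ.≤-Reasoning
  u = 18 ℕ.* B ℕ.+ 2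
  cubes : ∀ B → let u = 18 ℕ.* B ℕ.+ 2 ; t = u ℕ.* 3 in
    suc (suc (suc (2 ℕ.* t ℕ.* B) ℕ.* suc t)) ℕ.+ (1512 ℕ.* B ℕ.* B ℕ.+ 348 ℕ.* B ℕ.+ 18)
    ≡ suc u ℕ.* (suc u ℕ.* (suc u ℕ.* 1))
  cubes = solve-∀

evasive-for : ∀ B → ∃₂ λ t f → Evasive {block-dim B t} t f
evasive-for B = let t , room = enough-room B in
  t , evasive-exists (block-dim B t) t
    (subst (λ e → 2 ℕ.* e ℕ.< 2 ℕ.^ (2 ℕ.^ t)) (sym (ℕ.^-*-assoc 2 (block-dim B t) (suc t)))
      (ℕ.^-monoʳ-< 2 (ℕ.s≤s (ℕ.s≤s ℕ.z≤n)) room))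

-- Rational estimates

/1-homo : ∀ n → toℚᵘ (+ n / 1) ℚᵘ.≃ mkℚᵘ (+ n) 0
/1-homo n = ℚ.toℚᵘ-fromℚᵘ (mkℚᵘ (+ n) 0)

/1-mono-≤ : m ℕ.≤ n → + m / 1 ≤ + n / 1
/1-mono-≤ {m} {n} m≤n = ℚ.toℚᵘ-cancel-≤
  (ℚᵘ.≤-respˡ-≃ (ℚᵘ.≃-sym (/1-homo m)) (ℚᵘ.≤-respʳ-≃ (ℚᵘ.≃-sym (/1-homo n))
    (ℚᵘ.*≤* (ℤ.*-monoʳ-≤-nonNeg (+ 1) (ℤ.+≤+ m≤n)))))

/1<* : ∀ d a b .(c : Coprime a (suc b)) n → d ℕ.* suc b ℕ.< a ℕ.* n →
  + d / 1 < mkℚ (+ a) b c * (+ n / 1)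
/1<* d a b c n lt = ℚ.toℚᵘ-cancel-<
  (ℚᵘ.<-respˡ-≃ (ℚᵘ.≃-sym (/1-homo d))
    (ℚᵘ.<-respʳ-≃ (ℚᵘ.≃-sym (ℚᵘ.≃-trans (ℚ.toℚᵘ-homo-* (mkℚ (+ a) b c) (+ n / 1))
        (ℚᵘ.*-congˡ {mkℚᵘ (+ a) b} (/1-homo n))))
      (ℚᵘ.*<* (subst₂ ℤ._<_
        (trans (ℤ.pos-* d (suc b)) (cong (λ z → + d ℤ.* + z) (sym (ℕ.*-identityʳ (suc b)))))
        (trans (ℤ.pos-* a n) (sym (ℤ.*-identityʳ (+ a ℤ.* + n))))
        (ℤ.+<+ lt)))))

/1-nonNeg : ∀ n → NonNegative (+ n / 1)
/1-nonNeg n = ℚ.normalize-nonNeg n 1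

^ℚ-distrib-* : ∀ x y q → (x * y) ^ℚ q ≡ (x ^ℚ q) * (y ^ℚ q)
^ℚ-distrib-* x y zero    = refl
^ℚ-distrib-* x y (suc q) = trans (cong ((x * y) *_) (^ℚ-distrib-* x y q)) (interchange x y _ _)

^ℚ-pos : ∀ x .{{_ : Positive x}} q → Positive (x ^ℚ q)
^ℚ-pos x zero    = _
^ℚ-pos x (suc q) = ℚ.pos*pos⇒pos x (x ^ℚ q) {{^ℚ-pos x q}}

^ℚ-nonNeg : ∀ x .{{_ : NonNegative x}} q → NonNegative (x ^ℚ q)
^ℚ-nonNeg x zero    = _
^ℚ-nonNeg x (suc q) = ℚ.nonNeg*nonNeg⇒nonNeg x (x ^ℚ q) {{^ℚ-nonNeg x q}}

^ℚ-monoˡ-≤ : ∀ {x y} .{{_ : NonNegative x}} .{{_ : NonNegative y}} q → x ≤ y → x ^ℚ q ≤ y ^ℚ q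
^ℚ-monoˡ-≤ zero    x≤y = ℚ.≤-refl
^ℚ-monoˡ-≤ {x} {y} (suc q) x≤y = ℚ.≤-trans
  (ℚ.*-monoˡ-≤-nonNeg x (^ℚ-monoˡ-≤ q x≤y))
  (ℚ.*-monoʳ-≤-nonNeg (y ^ℚ q) {{^ℚ-nonNeg y q}} x≤y)

^ℚ-monoˡ-< : ∀ {x y} .{{_ : NonNegative x}} .{{_ : Positive y}} q → q ≥ 1 → x < y → x ^ℚ q < y ^ℚ q
^ℚ-monoˡ-< {x} {y} {{x≥0}} (suc q) _ x<y = ℚ.≤-<-trans
  (ℚ.*-monoˡ-≤-nonNeg x (^ℚ-monoˡ-≤ {{x≥0}} {{ℚ.pos⇒nonNeg y}} q (ℚ.<⇒≤ x<y)))
  (ℚ.*-monoˡ-<-pos (y ^ℚ q) {{^ℚ-pos y q}} x<y)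

^ℚ-monoʳ-≤ : ∀ {x} .{{_ : NonNegative x}} → 1ℚ ≤ x → ∀ {p q} → p ℕ.≤ q → x ^ℚ p ≤ x ^ℚ q
^ℚ-monoʳ-≤ 1≤x {q = zero}  ℕ.z≤n = ℚ.≤-refl
^ℚ-monoʳ-≤ {x} 1≤x {q = suc q} ℕ.z≤n = ℚ.≤-trans 1≤x (ℚ.≤-trans
  (ℚ.≤-reflexive (sym (ℚ.*-identityʳ x)))
  (ℚ.*-monoˡ-≤-nonNeg x (^ℚ-monoʳ-≤ 1≤x {q = q} ℕ.z≤n)))
^ℚ-monoʳ-≤ {x} 1≤x (ℕ.s≤s p≤q) = ℚ.*-monoˡ-≤-nonNeg x (^ℚ-monoʳ-≤ 1≤x p≤q)

archimedean : ∀ x → 0ℚ < x → ∃ λ n → n ≥ 1 × 1ℚ < x * (+ n / 1)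
-- The rational is (a + 1) / (b + 1), so n = b + 2 is large enough.
archimedean (mkℚ (+ suc a) b c) _ = suc (suc b) , ℕ.s≤s ℕ.z≤n ,
  /1<* 1 (suc a) b c (suc (suc b)) (ℕ.≤-trans
    (ℕ.≤-reflexive (cong (λ k → suc (suc k)) (ℕ.+-identityʳ b)))
    (ℕ.m≤m+n (suc (suc b)) _))
archimedean (mkℚ (+ zero) b c) (*<* (ℤ.+<+ ()))
archimedean (mkℚ -[1+ a ] b c) (*<* ())

-- Optimality of the exponent and the constant

-- The exponent is p / q; raising d ≥ C n^(p/q) to the power q keeps the inequality rational.
Claim : ℚ → ℕ → ℕ → Set
Claim C p q = (n : ℕ) (c : Colouring n) → Free c rainbow →
  Σ ℕ λ d → Σ (Embedding d n) λ V → Σ (Fin 3) λ i →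
    ((C ^ℚ q) * ((+ n / 1) ^ℚ p) ≤ (+ d / 1) ^ℚ q) × AvoidsColour c V i

-- No subspace exceeds dimension n. For n₀ ≥ 1 with C^q n₀ > 1, the claim for a constant colouring
-- gives d^q ≥ C^q n₀^(q+1) > n₀^q, which is too large.
exponent-optimal : ∀ C p q → p > q → 0ℚ < C → ¬ Claim C p q
exponent-optimal C p q p>q 0<C claim = ℚ.<-irrefl refl (begin-strict
  (+ d₀ / 1) ^ℚ q        ≤⟨ ^ℚ-monoˡ-≤ {{/1-nonNeg d₀}} {{/1-nonNeg n₀}} q
                             (/1-mono-≤ (injective⇒≤ (fun V) (Emb.injective V))) ⟩
  N ^ℚ q                ≡⟨ sym (ℚ.*-identityˡ _) ⟩
  1ℚ * (N ^ℚ q)         <⟨ ℚ.*-monoˡ-<-pos (N ^ℚ q) {{^ℚ-pos N q}} 1<DN ⟩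
  (D * N) * (N ^ℚ q)    ≡⟨ ℚ.*-assoc D N (N ^ℚ q) ⟩
  D * (N ^ℚ suc q)      ≤⟨ ℚ.*-monoˡ-≤-nonNeg D {{ℚ.pos⇒nonNeg D}}
                             (^ℚ-monoʳ-≤ {{/1-nonNeg n₀}} (/1-mono-≤ n₀≥1) p>q) ⟩
  D * (N ^ℚ p)          ≤⟨ proj₁ (proj₂ (proj₂ (proj₂ result))) ⟩
  (+ d₀ / 1) ^ℚ q        ∎)
  where
  open ℚ.≤-Reasoning
  D = C ^ℚ q
  instance
    D-pos : Positive D
    D-pos = ^ℚ-pos C {{positive 0<C}} q
  large = archimedean D (ℚ.positive⁻¹ D)
  n₀ = proj₁ large
  n₀≥1 = proj₁ (proj₂ large)
  1<DN = proj₂ (proj₂ large)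
  N = + n₀ / 1
  instance
    N-pos : Positive N
    N-pos = ℚ.normalize-pos n₀ 1 {{_}} {{ℕ.>-nonZero n₀≥1}}
  result = claim n₀ (const 0F) (triangleFree⇒free {n₀} (const 0F) λ _ _ _ _ _ ne _ _ → ne refl)
  d₀ = proj₁ result
  V = proj₁ (proj₂ result)

-- For C = a / B the stacked colouring has n = 3M, and the choice of `block-dim` makes every
-- colour-avoiding subspace have d < C n.
constant-optimal : ∀ C q → q ≥ 1 → ⅓ < C → ¬ Claim C q q
constant-optimal (mkℚ -[1+ _ ] _ _) _ _ (*<* ())
constant-optimal C@(mkℚ (+ a) b coprime) q q≥1 (*<* ⅓<C) claim =
  ℚ.<-irrefl refl (ℚ.<-≤-trans (begin-strict
    (+ d₀ / 1) ^ℚ q          <⟨ ^ℚ-monoˡ-< {{/1-nonNeg d₀}} {{CN-pos}} q q≥1 d₀<CN ⟩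
    (C * N) ^ℚ q             ≡⟨ ^ℚ-distrib-* C N q ⟩
    (C ^ℚ q) * (N ^ℚ q)      ∎)
    (proj₁ (proj₂ (proj₂ (proj₂ result)))))
  where
  open ℚ.≤-Reasoning
  B = suc b
  T = proj₁ (evasive-for B)
  f = proj₁ (proj₂ (evasive-for B))
  evasive = proj₂ (proj₂ (evasive-for B))
  M = block-dim B T
  N = + (M ℕ.+ (M ℕ.+ M)) / 1
  result = claim _ (three-blocks f evasive)
    (triangleFree⇒free (three-blocks f evasive) (three-blocks-triangleFree f evasive))
  d₀ = proj₁ result

  d₀≤ : d₀ ℕ.≤ M ℕ.+ (T ℕ.+ T)
  d₀≤ = let _ , V , i , _ , avoids = result in three-blocks-avoiding f evasive i (V , avoids)

  B<3a : B ℕ.< a ℕ.* 3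
  B<3a = subst (ℕ._< a ℕ.* 3) (ℕ.*-identityˡ B)
    (ℤ.drop‿+<+ (subst₂ ℤ._<_ (sym (ℤ.pos-* 1 B)) (sym (ℤ.pos-* a 3)) ⅓<C))

  d₀B<3aM : d₀ ℕ.* B ℕ.< a ℕ.* (M ℕ.+ (M ℕ.+ M))
  d₀B<3aM = ℕ.≤-trans (ℕ.s≤s (ℕ.*-monoˡ-≤ B d₀≤)) (ℕ.≤-trans
    (ℕ.≤-reflexive (expand T B)) (ℕ.≤-trans (ℕ.*-monoʳ-≤ M B<3a) (ℕ.≤-reflexive (triple a M))))
    where
    expand : ∀ t B → let m = suc (2 ℕ.* t ℕ.* B) in suc ((m ℕ.+ (t ℕ.+ t)) ℕ.* B) ≡ m ℕ.* suc B
    expand = solve-∀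
    triple : ∀ a m → m ℕ.* (a ℕ.* 3) ≡ a ℕ.* (m ℕ.+ (m ℕ.+ m))
    triple = solve-∀

  d₀<CN : + d₀ / 1 < C * N
  d₀<CN = /1<* d₀ a b coprime (M ℕ.+ (M ℕ.+ M)) d₀B<3aM

  CN-pos : Positive (C * N)
  CN-pos = positive (ℚ.≤-<-trans (ℚ.nonNegative⁻¹ (+ d₀ / 1) {{/1-nonNeg d₀}}) d₀<CN)

theorem1p6 :
  ((n : ℕ) (c : Colouring n) → Free c rainbow →
    Σ ℕ λ d → Σ (Embedding d n) λ V → Σ (Fin 3) λ i →
      (3 ℕ.* d ≥ n) × AvoidsColour c V i)
  ×
  ((C : ℚ) (p q : ℕ) → q ≥ 1 →
    ((p > q × 0ℚ < C) ⊎ (p ≡ q × ⅓ < C)) →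
    ¬ ((n : ℕ) (c : Colouring n) → Free c rainbow →
        Σ ℕ λ d → Σ (Embedding d n) λ V → Σ (Fin 3) λ i →
          ((C ^ℚ q) * ((+ n / 1) ^ℚ p) ≤ (+ d / 1) ^ℚ q)
          × AvoidsColour c V i))
theorem1p6 = avoiding-third , λ
  { C p q q≥1 (inj₁ (p>q , 0<C))   → exponent-optimal C p q p>q 0<C
  ; C p .p q≥1 (inj₂ (refl , ⅓<C)) → constant-optimal C p q≥1 ⅓<C }
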